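{- For integers $n,k,\ell\ge 0$ let $G_{n,k}(\ell)$ denote the number of acyclic orientations of the complete bipartite graph $K_{n,k}$ (with labeled vertices and parts of sizes $n$ and $k$) whose longest directed path has length equal to $\ell$. Then the generating function $$F(x,y,u)=\sum_{n,k,\ell\ge 0} G_{n,k}(\ell)\,u^{\ell}\,\frac{x^n}{n!}\,\frac{y^k}{k!}$$ satisfies $$F(x,y,u)=\frac{e^{x+y}-(u-1)^2(e^{x}-1)(e^{y}-1)}{1-u^2(e^x-1)(e^y-1)}.$$
   Context: An acyclic orientation of a graph is an assignment of a direction to each edge such that no directed cycle is formed. The length of a directed path is its number of edges. $K_{n,k}$ denotes the complete bipartite graph with parts of sizes $n$ and $k$; vertices are labeled, so orientations are counted as distinct assignments of directions to the edges. If $n=0$ or $k=0$ the graph has no edges, and it has exactly one (empty) acyclic orientation, with longest path length $0$ (this includes $n=k=0$). The identity is one of formal power series in $x,y,u$. -}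

module Defs where

open import Data.Bool using (Bool; true; false)
import Data.Bool.Properties as Bool
open import Data.Fin using (Fin; join; splitAt)
import Data.Fin.Properties as Fin
open import Data.Integer using (+_)
open import Data.List using (List; []; _∷_; length; filter; cartesianProductWith)
open import Data.Nat using (ℕ; zero; suc; _∸_; _≤_; _!)
import Data.Nat as ℕ
import Data.Nat.Properties as ℕ
open import Data.Product using (∃; _×_; _,_)
open import Data.Rational using (ℚ; 0ℚ; 1ℚ; _/_)
import Data.Rational as ℚ
open import Data.Sum using (_⊎_; inj₁; inj₂; [_,_]′)
open import Data.Sum.Properties using (≡-dec)
open import Data.Vec using (Vec; []; _∷_; lookup; head; last)
import Data.Vec.Relation.Unary.AllPairs as AllPairs
open import Data.Vec.Relation.Unary.Linked using (Linked; linked?)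
open import Data.Vec.Relation.Unary.Unique.Propositional using (Unique)
open import Data.Vec.Relation.Unary.Unique.Propositional.Properties using (lookup-injective)
open import Relation.Binary.PropositionalEquality using (_≡_; cong; sym; trans)
open import Relation.Nullary using (¬_; Dec; no)
open import Relation.Nullary.Decidable using (map′; ¬?; _×-dec_; _⊎-dec_; _→-dec_)

-- The edges of K_{n,k} are the pairs (i , j) : Fin n × Fin k, and entry (i , j)
-- gives the direction of that edge: true is left-to-right, false right-to-left.
Orientation : ℕ → ℕ → Set
Orientation n k = Vec (Vec Bool k) n

Vertex : ℕ → ℕ → Set
Vertex n k = Fin n ⊎ Fin k

module _ {n k : ℕ} where

  data Arc (o : Orientation n k) : Vertex n k → Vertex n k → Set where
    l→r : ∀ {i j} → lookup (lookup o i) j ≡ true  → Arc o (inj₁ i) (inj₂ j)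
    r→l : ∀ {i j} → lookup (lookup o i) j ≡ false → Arc o (inj₂ j) (inj₁ i)

  IsPath : Orientation n k → ∀ {m} → Vec (Vertex n k) m → Set
  IsPath o vs = Linked (Arc o) vs × Unique vs

  IsCycle : Orientation n k → ∀ {m} → Vec (Vertex n k) (suc m) → Set
  IsCycle o vs = IsPath o vs × Arc o (last vs) (head vs)

  Acyclic : Orientation n k → Set
  Acyclic o = ∀ m → ¬ ∃ λ (vs : Vec (Vertex n k) (suc m)) → IsCycle o vs

  -- Length counts edges, so a path of length ℓ visits 1 + ℓ vertices.
  HasPath : Orientation n k → ℕ → Set
  HasPath o ℓ = ∃ λ (vs : Vec (Vertex n k) (suc ℓ)) → IsPath o vs

  -- The alternative ℓ ≡ 0 only matters for n = k = 0: every other K_{n,k} has a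
  -- vertex, hence a path of length 0, while for the empty graph the longest path
  -- length is 0 by convention.
  LongestPath : Orientation n k → ℕ → Set
  LongestPath o ℓ = (HasPath o ℓ ⊎ ℓ ≡ 0) × (∀ ℓ′ → HasPath o ℓ′ → ℓ′ ≤ ℓ)

  arc? : ∀ o v w → Dec (Arc o v w)
  arc? o (inj₁ i) (inj₂ j) = map′ l→r (λ { (l→r e) → e }) (lookup (lookup o i) j Bool.≟ true)
  arc? o (inj₂ j) (inj₁ i) = map′ r→l (λ { (r→l e) → e }) (lookup (lookup o i) j Bool.≟ false)
  arc? o (inj₁ _) (inj₁ _) = no λ ()
  arc? o (inj₂ _) (inj₂ _) = no λ ()

  isPath? : ∀ o {m} (vs : Vec (Vertex n k) m) → Dec (IsPath o vs)
  isPath? o vs =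
    linked? (arc? o) vs ×-dec AllPairs.allPairs? (λ v w → ¬? (≡-dec Fin._≟_ Fin._≟_ v w)) vs

  anyVertex? : {P : Vertex n k → Set} → (∀ v → Dec (P v)) → Dec (∃ P)
  anyVertex? P? = map′
    [ (λ (i , p) → inj₁ i , p) , (λ (j , p) → inj₂ j , p) ]′
    (λ { (inj₁ i , p) → inj₁ (i , p) ; (inj₂ j , p) → inj₂ (j , p) })
    (Fin.any? (λ i → P? (inj₁ i)) ⊎-dec Fin.any? (λ j → P? (inj₂ j)))

  anyVec? : ∀ m {P : Vec (Vertex n k) m → Set} → (∀ vs → Dec (P vs)) → Dec (∃ P)
  anyVec? zero    P? = map′ (λ p → [] , p) (λ { ([] , p) → p }) (P? [])
  anyVec? (suc m) P? = map′
    (λ (v , vs , p) → v ∷ vs , p)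
    (λ { (v ∷ vs , p) → v , vs , p })
    (anyVertex? (λ v → anyVec? m (λ vs → P? (v ∷ vs))))

  unique⇒≤ : ∀ {m} {vs : Vec (Vertex n k) m} → Unique vs → m ≤ n ℕ.+ k
  unique⇒≤ {vs = vs} u = Fin.injective⇒≤ {f = λ i → join n k (lookup vs i)}
    (λ {i} {j} e → lookup-injective u i j
      (trans (sym (Fin.splitAt-join n k (lookup vs i)))
        (trans (cong (splitAt n) e) (Fin.splitAt-join n k (lookup vs j)))))

  acyclic? : ∀ o → Dec (Acyclic o)
  acyclic? o = map′
    (λ h m → λ { (vs , c@((_ , u) , _)) → h (unique⇒≤ u) (vs , c) })
    (λ a {m} _ → a m)
    (ℕ.allUpTo? (λ m → ¬? (anyVec? (suc m) (λ vs → isPath? o vs ×-dec arc? o (last vs) (head vs))))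
      (n ℕ.+ k))

  hasPath? : ∀ o ℓ → Dec (HasPath o ℓ)
  hasPath? o ℓ = anyVec? (suc ℓ) (isPath? o)

  longestPath? : ∀ o ℓ → Dec (LongestPath o ℓ)
  longestPath? o ℓ = (hasPath? o ℓ ⊎-dec ℓ ℕ.≟ 0) ×-dec map′
    (λ h ℓ′ → λ { (vs , p@(_ , u)) → h (unique⇒≤ u) (vs , p) })
    (λ a {ℓ′} _ → a ℓ′)
    (ℕ.allUpTo? (λ ℓ′ → hasPath? o ℓ′ →-dec ℓ′ ℕ.≤? ℓ) (n ℕ.+ k))

allVecs : {A : Set} → List A → ∀ m → List (Vec A m)
allVecs xs zero    = [] ∷ []
allVecs xs (suc m) = cartesianProductWith _∷_ xs (allVecs xs m)

allOrientations : ∀ n k → List (Orientation n k)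
allOrientations n k = allVecs (allVecs (true ∷ false ∷ []) k) n

G : ℕ → ℕ → ℕ → ℕ
G n k ℓ = length (filter (λ o → acyclic? o ×-dec longestPath? o ℓ) (allOrientations n k))

-- A formal power series in x, y, u over ℚ: A n k ℓ is the coefficient of x^n y^k u^ℓ.
Series : Set
Series = ℕ → ℕ → ℕ → ℚ

infix  4 _≈_
infixl 6 _+_ _-_
infixl 7 _*_
infixr 8 _^_

_≈_ : Series → Series → Set
A ≈ B = ∀ n k ℓ → A n k ℓ ≡ B n k ℓ

∑≤ : ℕ → (ℕ → ℚ) → ℚ
∑≤ zero    f = f 0
∑≤ (suc m) f = ∑≤ m f ℚ.+ f (suc m)

_+_ _-_ _*_ : Series → Series → Series
(A + B) n k ℓ = A n k ℓ ℚ.+ B n k ℓ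
(A - B) n k ℓ = A n k ℓ ℚ.- B n k ℓ
(A * B) n k ℓ =
  ∑≤ n λ a → ∑≤ k λ b → ∑≤ ℓ λ c → A a b c ℚ.* B (n ∸ a) (k ∸ b) (ℓ ∸ c)

one x y u : Series
one 0 0 0 = 1ℚ
one _ _ _ = 0ℚ
x 1 0 0 = 1ℚ
x _ _ _ = 0ℚ
y 0 1 0 = 1ℚ
y _ _ _ = 0ℚ
u 0 0 1 = 1ℚ
u _ _ _ = 0ℚ

_^_ : Series → ℕ → Series
A ^ zero  = one
A ^ suc m = A * A ^ m

1/_! : ℕ → ℚ
1/ m ! = (+ 1 / m !) ⦃ m ℕ.!≢0 ⦄

-- Σ_m A^m / m!, for A with zero constant term; then A^m has no terms of total
-- degree below m, so truncating the sum at the total degree is exact.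
exp : Series → Series
exp A n k ℓ = ∑≤ (n ℕ.+ k ℕ.+ ℓ) λ m → (A ^ m) n k ℓ ℚ.* 1/ m !

-- A = N / D in the ring of formal power series: D is a unit and A = N D⁻¹.
_IsQuotient_÷_ : Series → Series → Series → Set
A IsQuotient N ÷ D = ∃ λ (D⁻¹ : Series) → (D * D⁻¹ ≈ one) × (A ≈ N * D⁻¹)

F : Series
F n k ℓ = (+ G n k ℓ / 1) ℚ.* 1/ n ! ℚ.* 1/ k !

{-# OPTIONS --safe #-}

-- Give each vertex of an acyclic orientation its height, the length of a longest
-- path starting there. The ends of an edge have different heights and a vertex of
-- height m + 1 has an arc to one of height m, so the heights 0, …, ℓ alternate between
-- the two sides of K_{n,k}; conversely any pair of surjections of the two sides onto
-- the even and the odd (or the odd and the even) numbers up to ℓ is the height function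
-- of exactly one acyclic orientation. As the surjections onto m letters have
-- exponential generating function (e^t − 1)^m, with X = e^x − 1 and Y = e^y − 1 this gives
--   F = 1 + (X + Y + 2uXY) / (1 − u²XY),
-- the 1 being the orientation of the empty graph.
module Submission where

-- No inverse pair of maps between orientations and pairs of surjections is built. The relation "`o`
-- has height function `h`" determines each of its ends from the other and leaves no end unmatched,
-- so it bounds the length of each finite list by that of the other. Counting surjections by their
-- first value leaves a letter that may but need not occur again, so the count is generalised to
-- words with optional and obligatory letters. The resulting recurrence S(n+1, m+1) = (m+1) (S(n, m)
-- + S(n, m+1)) is, on coefficients, the rule for differentiating (e^t - 1)^(m+1); this gives the
-- generating function. Products of three-variable series are triple sums, tamed by shape: a series
-- is either a(x) b(y) c(u), or, like 1 / (1 - u²XY), has as coefficient of each u^ℓ a series in x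
-- times a series in y. Such products reduce to one-variable convolutions. The fraction appears by
-- splitting its numerator as the denominator plus X + Y + 2uXY.

module Heights where

  open import Defs using (Orientation; Vertex; Arc; l→r; r→l; IsPath; Acyclic; HasPath; LongestPath; isPath?; anyVec?; unique⇒≤)
  open import Data.Bool using (Bool; true; false; not; T)
  open import Data.Bool.Properties using (_≟_; not-¬; ¬-not; not-involutive; not-injective)
  open import Data.Fin using (Fin)
  import Data.Fin.Properties as Fin
  open import Data.Nat using (ℕ; zero; suc; _+_; _≤_; _<_; _∸_; _<ᵇ_; z≤n; s≤s)
  open import Data.Nat.Properties hiding (_≟_)
  open import Data.Unit using (tt)
  open import Data.Product using (∃; ∃₂; _×_; _,_; proj₁; proj₂)
  open import Data.Sum using (_⊎_; inj₁; inj₂)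
  open import Data.Sum.Properties using (≡-dec)
  open import Data.Vec using (Vec; []; _∷_; lookup; head; last; tabulate)
  open import Data.Vec.Properties using (tabulate∘lookup; tabulate-cong; lookup∘tabulate)
  open import Data.Vec.Relation.Unary.All as All using (All; []; _∷_)
  open import Data.Vec.Relation.Unary.Any using (here; there)
  import Data.Vec.Relation.Unary.AllPairs as AllPairs
  open AllPairs using ([]; _∷_)
  open import Data.Vec.Relation.Unary.Linked using (Linked; []; [-]; _∷_)
  open import Data.Vec.Membership.Propositional using (_∈_)
  import Data.Vec.Membership.DecPropositional as DecMembership
  open import Function using (_∘_)
  open import Relation.Binary.PropositionalEquality
  open import Relation.Nullary using (¬_; Dec; yes; no; contradiction)
  open import Relation.Nullary.Decidable using (dec-true; dec-false)

  lookup-ext : ∀ {A : Set} {m} {xs ys : Vec A m} → (∀ i → lookup xs i ≡ lookup ys i) → xs ≡ ys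
  lookup-ext {xs = xs} {ys} e =
    trans (sym (tabulate∘lookup xs)) (trans (tabulate-cong e) (tabulate∘lookup ys))

  maximum : ∀ {P : ℕ → Set} → (∀ m → Dec (P m)) → P 0 →
            ∀ b → ∃ λ m → P m × (∀ {m′} → m′ ≤ b → P m′ → m′ ≤ m)
  maximum P? p₀ zero = 0 , p₀ , λ m′≤0 _ → m′≤0
  maximum P? p₀ (suc b) with P? (suc b)
  ... | yes p = suc b , p , λ m′≤b _ → m′≤b
  ... | no ¬p with maximum P? p₀ b
  ...   | m , p , max = m , p , bound
    where
    bound : ∀ {m′} → m′ ≤ suc b → _ → m′ ≤ m
    bound m′≤b p′ with m≤n⇒m<n∨m≡n m′≤b
    ... | inj₁ (s≤s m′≤b′) = max m′≤b′ p′
    ... | inj₂ refl        = contradiction p′ ¬p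

  -- Height functions of acyclic orientations.

  module _ {n k : ℕ} where

    open DecMembership (≡-dec (Fin._≟_ {n}) (Fin._≟_ {k})) using (_∈?_)

    -- An acyclic orientation has exactly one height function, sending a vertex to
    -- the length of a longest path starting there.
    record IsHeight (o : Orientation n k) (h : Vertex n k → ℕ) : Set where
      field
        descends : ∀ {v w} → Arc o v w → h w < h v
        step     : ∀ {v m} → h v ≡ suc m → ∃ λ w → Arc o v w × h w ≡ m

    open IsHeight

    IsHeight-resp : ∀ {o h h′} → (∀ v → h′ v ≡ h v) → IsHeight o h → IsHeight o h′
    IsHeight-resp e H = record
      { descends = λ a → subst₂ _<_ (sym (e _)) (sym (e _)) (descends H a)
      ; step     = λ p → let w , a , q = step H (trans (sym (e _)) p) in w , a , trans (e w) q }

    arc-total : ∀ (o : Orientation n k) i j → Arc o (inj₁ i) (inj₂ j) ⊎ Arc o (inj₂ j) (inj₁ i)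
    arc-total o i j with lookup (lookup o i) j in e
    ... | true  = inj₁ (l→r e)
    ... | false = inj₂ (r→l e)

    -- Following a `step` arc lowers `h` by exactly one and `h′` by at least one.
    height-≤ : ∀ {o h h′} → IsHeight o h → IsHeight o h′ → ∀ m {v} → h v ≡ m → m ≤ h′ v
    height-≤ H H′ zero    _ = z≤n
    height-≤ H H′ (suc m) e with step H e
    ... | w , a , e′ = ≤-<-trans (height-≤ H H′ m e′) (descends H′ a)

    height-unique : ∀ {o h h′} → IsHeight o h → IsHeight o h′ → ∀ v → h v ≡ h′ v
    height-unique H H′ v = ≤-antisym (height-≤ H H′ _ refl) (height-≤ H′ H _ refl)

    -- Every edge points to its lower end, so the heights dictate each direction.
    orientation-unique : ∀ {o o′ h} → IsHeight o h → IsHeight o′ h → o ≡ o′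
    orientation-unique {o} {o′} H H′ = lookup-ext λ i → lookup-ext λ j → entry i j
      where
      entry : ∀ i j → lookup (lookup o i) j ≡ lookup (lookup o′ i) j
      entry i j with lookup (lookup o i) j in e | lookup (lookup o′ i) j in e′
      ... | true  | true  = refl
      ... | false | false = refl
      ... | true  | false = contradiction (descends H (l→r e)) (<-asym (descends H′ (r→l e′)))
      ... | false | true  = contradiction (descends H (r→l e)) (<-asym (descends H′ (l→r e′)))

    last-≤-head : ∀ {o h} → IsHeight o h → ∀ {m} {vs : Vec (Vertex n k) (suc m)} →
                  Linked (Arc o) vs → h (last vs) ≤ h (head vs)
    last-≤-head H [-] = ≤-refl
    last-≤-head H (a ∷ as) = ≤-trans (last-≤-head H as) (<⇒≤ (descends H a))

    height⇒acyclic : ∀ {o h} → IsHeight o h → Acyclic o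
    height⇒acyclic H m (vs , (as , _) , a) = <⇒≱ (descends H a) (last-≤-head H as)

    length-≤-height : ∀ {o h} → IsHeight o h → ∀ {m} {vs : Vec (Vertex n k) (suc m)} →
                      Linked (Arc o) vs → m ≤ h (head vs)
    length-≤-height H [-] = z≤n
    length-≤-height H (a ∷ as) = ≤-<-trans (length-≤-height H as) (descends H a)

    -- `step` arcs are followed down to height 0. The bound on the heights is carried along because
    -- it makes each new vertex, which lies strictly higher, distinct from all later ones.
    descend : ∀ {o h} → IsHeight o h → ∀ m v → h v ≡ m →
              ∃ λ (vs : Vec (Vertex n k) (suc m)) →
                IsPath o vs × head vs ≡ v × All (λ w → h w ≤ m) vs
    descend H zero v e = v ∷ [] , ([-] , [] ∷ []) , refl , ≤-reflexive e ∷ []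
    descend {h = h} H (suc m) v e with step H e
    ... | w , a , e′ with descend H m w e′
    ...   | vs , (as , un) , refl , small =
      v ∷ vs , (a ∷ as , All.map fresh small ∷ un) , refl ,
      ≤-reflexive e ∷ All.map m≤n⇒m≤1+n small
      where
      fresh : ∀ {w} → h w ≤ m → v ≢ w
      fresh hw≤m refl = 1+n≰n (subst (_≤ m) e hw≤m)

    -- An arc from `w` back to the head closes the segment ending at `w` to a cycle. The last
    -- component keeps a vertex prepended in the recursion distinct from those of the segment.
    prefix : ∀ {o m} {vs : Vec (Vertex n k) (suc m)} {w} → IsPath o vs → w ∈ vs →
             ∃₂ λ m′ (us : Vec (Vertex n k) (suc m′)) → IsPath o us × head us ≡ head vs ×
               last us ≡ w × (∀ {v} → All (v ≢_) vs → All (v ≢_) us)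
    prefix {vs = v ∷ _} _ (here refl) =
      0 , v ∷ [] , ([-] , [] ∷ []) , refl , refl , λ { (p ∷ _) → p ∷ [] }
    prefix {vs = v ∷ _ ∷ _} (a ∷ as , f ∷ un) (there w∈) with prefix (as , un) w∈
    ... | m′ , us , (as′ , un′) , refl , refl , sub =
      suc m′ , v ∷ us , (a ∷ as′ , sub f ∷ un′) , refl , refl , λ { (p ∷ ps) → p ∷ sub ps }

    -- The search for a longest path may stop at `n + k`, since the vertices of a path are distinct.
    acyclic⇒height : ∀ (o : Orientation n k) → Acyclic o → ∃ (IsHeight o)
    acyclic⇒height o acyclic = height , record { descends = desc ; step = stp }
      where
      PathFrom : Vertex n k → ℕ → Set
      PathFrom v m = ∃ λ (vs : Vec (Vertex n k) m) → IsPath o (v ∷ vs)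

      longest : ∀ v → ∃ λ m → PathFrom v m × (∀ {m′} → m′ ≤ n + k → PathFrom v m′ → m′ ≤ m)
      longest v = maximum (λ m → anyVec? m (λ vs → isPath? o (v ∷ vs))) ([] , [-] , [] ∷ []) (n + k)

      height : Vertex n k → ℕ
      height = proj₁ ∘ longest

      height-max : ∀ {v m} → PathFrom v m → m ≤ height v
      height-max {v} p@(_ , _ , un) = proj₂ (proj₂ (longest v)) (<⇒≤ (unique⇒≤ un)) p

      -- A longest path from `w` is extended by `v` in front; if it already visits `v`, its part up
      -- to `v` and the arc from `v` to `w` form a cycle.
      desc : ∀ {v w} → Arc o v w → height w < height v
      desc {v} {w} a with longest w
      ... | m , (vs , as , un) , _ with v ∈? (w ∷ vs)
      ...   | no v∉ = height-max (w ∷ vs , a ∷ as , fresh v∉ ∷ un)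
        where
        fresh : ∀ {m} {us : Vec (Vertex n k) m} → ¬ v ∈ us → All (v ≢_) us
        fresh {us = []}     _  = []
        fresh {us = _ ∷ _} v∉ = (λ e → v∉ (here e)) ∷ fresh (v∉ ∘ there)
      ...   | yes v∈ with prefix (as , un) v∈
      ...     | m′ , us , path , refl , refl , _ = contradiction (us , path , a) (acyclic m′)

      firstArc : ∀ {v l m} → PathFrom v l → l ≡ suc m → ∃ λ w → Arc o v w × PathFrom w m
      firstArc (w ∷ vs , a ∷ as , _ ∷ un) refl = w , a , vs , as , un

      stp : ∀ {v m} → height v ≡ suc m → ∃ λ w → Arc o v w × height w ≡ m
      stp {v} e with firstArc (proj₁ (proj₂ (longest v))) e
      -- The tail of a longest path from `v` bounds the height of `w` from below, `desc` from above.
      ... | w , a , p = w , a , ≤-antisym (≤-pred (subst (height w <_) e (desc a))) (height-max p)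

  -- Height functions as pairs of surjections onto the levels of either parity.

  even : ℕ → Bool
  even zero    = true
  even (suc m) = not (even m)

  -- For `b = false` and `ℓ = 0` there is no level at all, which forces the domain to be empty; this
  -- is how graphs with one empty side fit in.
  Onto : Bool → ℕ → ∀ {m} → (Fin m → ℕ) → Set
  Onto b ℓ h =
    (∀ i → h i ≤ ℓ × even (h i) ≡ b) × (∀ {l} → l ≤ ℓ → even l ≡ b → ∃ λ i → h i ≡ l)

  module _ {n k : ℕ} where

    open IsHeight

    module _ {s ℓ} {h : Vertex n k → ℕ} (L : Onto s ℓ (h ∘ inj₁)) (R : Onto (not s) ℓ (h ∘ inj₂)) where

      -- Edges point to the lower end, and opposite parities exclude ties. A vertex at level m + 1
      -- has its arc to level m because the other side attains that level and every two vertices on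
      -- opposite sides are adjacent.
      levels⇒height : ∃ λ (o : Orientation n k) → IsHeight o h
      levels⇒height = o , record { descends = desc ; step = stp }
        where
        o : Orientation n k
        o = tabulate λ i → tabulate λ j → h (inj₂ j) <ᵇ h (inj₁ i)

        entry : ∀ i j → lookup (lookup o i) j ≡ (h (inj₂ j) <ᵇ h (inj₁ i))
        entry i j = trans (cong (λ r → lookup r j) (lookup∘tabulate _ i)) (lookup∘tabulate _ j)

        apart : ∀ i j → h (inj₁ i) ≢ h (inj₂ j)
        apart i j e = not-¬ refl
          (trans (sym (proj₂ (proj₁ L i))) (trans (cong even e) (proj₂ (proj₁ R j))))

        desc : ∀ {v w} → Arc o v w → h w < h v
        desc (l→r {i} {j} e) = <ᵇ⇒< _ _ (subst T (trans (sym e) (entry i j)) tt)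
        desc (r→l {i} {j} e) =
          ≤∧≢⇒< (≮⇒≥ (λ p → subst T (trans (sym (entry i j)) e) (<⇒<ᵇ p))) (apart i j)

        stp : ∀ {v m} → h v ≡ suc m → ∃ λ w → Arc o v w × h w ≡ m
        stp {inj₁ i} {m} e with proj₁ L i
        ... | le , p with proj₂ R (≤-trans (n≤1+n m) (subst (_≤ ℓ) e le))
                               (trans (sym (not-involutive _)) (cong not (trans (cong even (sym e)) p)))
        ...   | j , e′ = inj₂ j , l→r (trans (entry i j) (dec-true (_ <? _) lt)) , e′
          where
          lt : h (inj₂ j) < h (inj₁ i)
          lt = ≤-reflexive (trans (cong suc e′) (sym e))
        stp {inj₂ j} {m} e with proj₁ R j
        ... | le , p with proj₂ L (≤-trans (n≤1+n m) (subst (_≤ ℓ) e le))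
                               (not-injective (trans (cong even (sym e)) p))
        ...   | i , e′ = inj₁ i , r→l (trans (entry i j) (dec-false (_ <? _) (<-asym lt))) , e′
          where
          lt : h (inj₁ i) < h (inj₂ j)
          lt = ≤-reflexive (trans (cong suc e′) (sym e))

      levels⇒longest : ∀ {o} → IsHeight o h → LongestPath o ℓ
      levels⇒longest {o} H = inj₁ longest , λ { _ (_ , as , _) → ≤-trans (length-≤-height H as) (bounded _) }
        where
        bounded : ∀ v → h v ≤ ℓ
        bounded (inj₁ i) = proj₁ (proj₁ L i)
        bounded (inj₂ j) = proj₁ (proj₁ R j)

        top : ∃ λ v → h v ≡ ℓ
        top with even ℓ ≟ s
        ... | yes e = let i , p = proj₂ L ≤-refl e in inj₁ i , p
        ... | no ¬e = let j , p = proj₂ R ≤-refl (¬-not ¬e) in inj₂ j , p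

        longest : HasPath o ℓ
        longest = let v , e = top ; vs , path , _ = descend H ℓ v e in vs , path

    module _ {o : Orientation n k} {h : Vertex n k → ℕ} (H : IsHeight o h) where

      -- The parity that a vertex prescribes for the left side. An arc changes sides, so it
      -- preserves the colour when the height drops by one.
      colour : Vertex n k → Bool
      colour (inj₁ i) = even (h (inj₁ i))
      colour (inj₂ j) = not (even (h (inj₂ j)))

      colour-arc : ∀ {v w m} → Arc o v w → h v ≡ suc m → h w ≡ m → colour w ≡ colour v
      colour-arc (l→r _) e e′ = trans (cong (not ∘ even) e′) (cong even (sym e))
      colour-arc {m = m} (r→l _) e e′ =
        trans (cong even e′) (trans (sym (not-involutive (even m))) (cong (not ∘ even) (sym e)))

      -- Serves twice: descending to height 0 compares the colours of any two vertices, and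
      -- descending from a vertex of height `ℓ` shows that every level is attained.
      lower : ∀ d {m v} → h v ≡ d + m → ∃ λ w → h w ≡ m × colour w ≡ colour v
      lower zero    {v = v} e = v , e , refl
      lower (suc d) e with step H e
      ... | w , a , e′ = let w′ , p , c = lower d e′ in w′ , p , trans c (colour-arc a e e′)

      no-equal-heights : ∀ {i j} → h (inj₁ i) ≢ h (inj₂ j)
      no-equal-heights {i} {j} e with arc-total o i j
      ... | inj₁ a = <-irrefl (sym e) (descends H a)
      ... | inj₂ a = <-irrefl e (descends H a)

      -- Adjacent vertices have different heights, so the vertices of height 0 all lie
      -- on one side; descending along arcs of height difference 1 preserves the colour.
      colour-constant : ∀ v w → colour v ≡ colour w
      colour-constant v w with lower (h v) {0} (sym (+-identityʳ _)) | lower (h w) {0} (sym (+-identityʳ _))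
      ... | v′ , e , c | w′ , e′ , c′ = trans (sym c) (trans (ground v′ w′ e e′) c′)
        where
        ground : ∀ v w → h v ≡ 0 → h w ≡ 0 → colour v ≡ colour w
        ground (inj₁ _) (inj₁ _) e e′ = cong even (trans e (sym e′))
        ground (inj₂ _) (inj₂ _) e e′ = cong (not ∘ even) (trans e (sym e′))
        ground (inj₁ _) (inj₂ _) e e′ = contradiction (trans e (sym e′)) no-equal-heights
        ground (inj₂ _) (inj₁ _) e e′ = contradiction (trans e′ (sym e)) no-equal-heights

      -- The vertex `v` fixes which side carries the even levels. A level of the left parity
      -- attained on the right would give that vertex the wrong colour, and vice versa.
      height⇒levels : ∀ {ℓ} → LongestPath o ℓ → (v : Vertex n k) →
                      Onto (colour v) ℓ (h ∘ inj₁) × Onto (not (colour v)) ℓ (h ∘ inj₂)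
      height⇒levels {ℓ} (long , max) v =
        ( (λ i → bounded _ , colour-constant (inj₁ i) v)
        , λ le e → onLeft e (attained le) ) ,
        ( (λ j → bounded _ , trans (sym (not-involutive _)) (cong not (colour-constant (inj₂ j) v)))
        , λ le e → onRight e (attained le) )
        where
        bounded : ∀ w → h w ≤ ℓ
        bounded w = let vs , path , _ = descend H (h w) w refl in max _ (vs , path)

        top : HasPath o ℓ ⊎ ℓ ≡ 0 → ∃ λ w → h w ≡ ℓ
        top (inj₁ (vs , as , _)) = head vs , ≤-antisym (bounded _) (length-≤-height H as)
        -- Here `v` itself will do, its height being squeezed between 0 and `ℓ`.
        top (inj₂ ℓ≡0)           = v , ≤-antisym (bounded v) (subst (_≤ h v) (sym ℓ≡0) z≤n)

        attained : ∀ {l} → l ≤ ℓ → ∃ λ w → h w ≡ l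
        attained {l} le = let w , e = top long
                              w′ , p , _ = lower (ℓ ∸ l) (trans e (sym (m∸n+n≡m le)))
                          in w′ , p

        onLeft : ∀ {l} → even l ≡ colour v → (∃ λ w → h w ≡ l) → ∃ λ i → h (inj₁ i) ≡ l
        onLeft e (inj₁ i , p) = i , p
        onLeft e (inj₂ j , p) = contradiction
          (trans (colour-constant v (inj₂ j)) (cong not (trans (cong even p) e))) (not-¬ refl)

        onRight : ∀ {l} → even l ≡ not (colour v) → (∃ λ w → h w ≡ l) → ∃ λ j → h (inj₂ j) ≡ l
        onRight e (inj₂ j , p) = j , p
        onRight e (inj₁ i , p) = contradiction
          (trans (colour-constant v (inj₁ i)) (trans (cong even p) e)) (not-¬ refl)

-- Comparing lengths of finite lists.

module Counting where

  open import Defs using (Orientation; Vertex; Acyclic; LongestPath; acyclic?; longestPath?; allVecs; allOrientations; G)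
  open import Data.Bool using (Bool; true; false; not)
  open import Data.Bool.Properties using (not-injective)
  open import Data.Fin using (Fin; zero; suc)
  import Data.Fin.Properties as Fin
  open import Data.List using (List; []; _∷_; _++_; map; length; filter; cartesianProduct; cartesianProductWith)
  open import Data.List.Properties using (length-map; length-++; length-removeAt′; filter-++; filter-≐; filter-all; filter-none; filter-accept; filter-reject)
  open import Data.List.Membership.Propositional using (_∈_; _∉_)
  open import Data.List.Membership.Propositional.Properties using (∈-map⁺; ∈-map⁻; ∈-++⁺ˡ; ∈-++⁺ʳ; ∈-++⁻; ∈-filter⁺; ∈-filter⁻; ∈-cartesianProductWith⁺; ∈-cartesianProductWith⁻; ∈-cartesianProduct⁺; ∈-cartesianProduct⁻)
  open import Data.List.Relation.Unary.All as All using (All; []; _∷_)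
  open import Data.List.Relation.Unary.Any using (here; there; index; _─_)
  open import Data.List.Relation.Unary.AllPairs using ([]; _∷_)
  open import Data.List.Relation.Unary.Unique.Propositional using (Unique)
  import Data.List.Relation.Unary.Unique.Propositional.Properties as Unique
  open import Data.Nat using (ℕ; zero; suc; _+_; _*_; _≤_; _≟_; z≤n; s≤s)
  open import Data.Nat.Properties hiding (_≟_)
  open import Data.Nat.Tactic.RingSolver using (solve-∀)
  open import Data.Product using (∃; _×_; _,_; proj₁; proj₂)
  open import Data.Sum using (inj₁; inj₂; [_,_]′)
  open import Data.Vec using (Vec; []; _∷_; lookup; tabulate)
  open import Data.Vec.Properties using (∷-injective; lookup∘tabulate)
  open import Function using (_∘_; _∘′_)
  open import Relation.Binary.PropositionalEquality
  open import Relation.Nullary using (¬_; yes; no; contradiction; ¬?; _×-dec_)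
  open import Relation.Unary using (Decidable)
  import Data.List.Membership.DecPropositional as DecMembership
  open DecMembership _≟_ using (_∈?_)

  open Heights

  module _ {A : Set} where

    ∈-─ : ∀ {y z : A} {ys} (p : y ∈ ys) → z ∈ ys → z ≢ y → z ∈ (ys ─ p)
    ∈-─ (here refl) (here e)  z≢y = contradiction e z≢y
    ∈-─ (here _)    (there q) _   = q
    ∈-─ (there p)   (here e)  _   = here e
    ∈-─ (there p)   (there q) z≢y = there (∈-─ p q z≢y)

  -- The pigeonhole principle, by deleting the partner of each matched element. It is stated for a
  -- relation so that one matching can be read in both directions.
  length-≤ : ∀ {A B : Set} (R : A → B → Set) → (∀ {x x′ y} → R x y → R x′ y → x ≡ x′) →
             ∀ {xs ys} → Unique xs → (∀ {x} → x ∈ xs → ∃ λ y → y ∈ ys × R x y) →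
             length xs ≤ length ys
  length-≤ R inj {[]}     {ys} _        total = z≤n
  length-≤ R inj {x ∷ xs} {ys} (x≢ ∷ u) total with total (here refl)
  ... | y , y∈ , r = subst (suc (length xs) ≤_) (sym (length-removeAt′ ys (index y∈))) (s≤s (length-≤ R inj u total′))
    where
    total′ : ∀ {x′} → x′ ∈ xs → ∃ λ y′ → y′ ∈ (ys ─ y∈) × R x′ y′
    total′ x′∈ with total (there x′∈)
    ... | y′ , y′∈ , r′ =
      y′ , ∈-─ y∈ y′∈ (λ { refl → All.lookup x≢ x′∈ (inj r r′) }) , r′

  length-filter-∈ : ∀ {xs ys : List ℕ} → Unique xs → Unique ys → (∀ {y} → y ∈ ys → y ∈ xs) →
                    length (filter (_∈? ys) xs) ≡ length ys
  length-filter-∈ {xs} {ys} ux uy sub = ≤-antisym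
    (length-≤ _≡_ (λ { refl refl → refl }) (Unique.filter⁺ (_∈? ys) ux)
      (λ x∈ → _ , proj₂ (∈-filter⁻ (_∈? ys) {xs = xs} x∈) , refl))
    (length-≤ _≡_ (λ { refl refl → refl }) uy
      (λ y∈ → _ , ∈-filter⁺ (_∈? ys) (sub y∈) y∈ , refl))

  module _ {A B : Set} {P : B → Set} (P? : Decidable P) where

    length-filter-map : ∀ (f : A → B) xs → length (filter P? (map f xs)) ≡ length (filter (P? ∘ f) xs)
    length-filter-map f [] = refl
    length-filter-map f (x ∷ xs) with P? (f x)
    ... | yes _ = cong suc (length-filter-map f xs)
    ... | no _  = length-filter-map f xs

  length-cartesianProduct : ∀ {A B : Set} (xs : List A) (ys : List B) →
                            length (cartesianProduct xs ys) ≡ length xs * length ys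
  length-cartesianProduct []       ys = refl
  length-cartesianProduct (x ∷ xs) ys =
    trans (length-++ (map (x ,_) ys))
      (cong₂ _+_ (length-map (x ,_) ys) (length-cartesianProduct xs ys))

  -- Words with obligatory letters, and surjections.

  Covers : ∀ {n} → List ℕ → Vec ℕ n → Set
  Covers ys v = ∀ {y} → y ∈ ys → ∃ λ i → lookup v i ≡ y

  covers? : ∀ {n} ys → Decidable (Covers {n} ys)
  covers? ys v with All.all? (λ y → Fin.any? (λ i → lookup v i ≟ y)) ys
  ... | yes p = yes (All.lookup p)
  ... | no ¬p = no (λ c → ¬p (All.tabulate c))

  -- words n c m counts the words of length n over c + m letters that use each of the last m.
  words : ℕ → ℕ → ℕ → ℕ
  words zero    c zero    = 1
  words zero    c (suc m) = 0
  words (suc n) c zero    = c * words n c zero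
  words (suc n) c (suc m) = suc m * words n (suc c) m + c * words n c (suc m)

  surjections : ℕ → ℕ → ℕ
  surjections n m = words n 0 m

  words-pascal : ∀ n c m → words n (suc c) m ≡ words n c m + words n c (suc m)
  words-pascal zero    c zero    = refl
  words-pascal zero    c (suc m) = refl
  words-pascal (suc n) c zero rewrite words-pascal n c zero =
    lemma c (words n c 0) (words n c 1)
    where
    lemma : ∀ c a b → suc c * (a + b) ≡ c * a + ((a + b) + 0 + c * b)
    lemma = solve-∀
  words-pascal (suc n) c (suc m)
    rewrite words-pascal n (suc c) m | words-pascal n c (suc m) =
    lemma c m (words n (suc c) m) (words n c (suc m)) (words n c (suc (suc m)))
    where
    lemma : ∀ c m a b d → suc m * (a + (b + d)) + suc c * (b + d)
          ≡ (suc m * a + c * b) + (suc (suc m) * (b + d) + c * d)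
    lemma = solve-∀

  -- After the first letter the recursion of `words` has one optional letter, which `words-pascal`
  -- eliminates. This is the recurrence that `∂-power` reproduces.
  surjections-suc : ∀ n m → surjections (suc n) (suc m) ≡ suc m * (surjections n m + surjections n (suc m))
  surjections-suc n m = trans (+-identityʳ _) (cong (suc m *_) (words-pascal n 0 m))

  coverings : List ℕ → List ℕ → ∀ n → List (Vec ℕ n)
  coverings xs ys n = filter (covers? ys) (allVecs xs n)

  differs? : ∀ x → Decidable (_≢ x)
  differs? x y = ¬? (y ≟ x)

  _without_ : List ℕ → ℕ → List ℕ
  ys without x = filter (differs? x) ys

  length-without : ∀ {x ys} → Unique ys → x ∈ ys → length ys ≡ suc (length (ys without x))
  length-without {x} {.x ∷ ys} (x≢ ∷ u) (here refl) = sym (cong (suc ∘′ length) removed)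
    where
    removed : (x ∷ ys) without x ≡ ys
    removed = trans (filter-reject (differs? x) (λ x≢x → x≢x refl))
      (filter-all (differs? x) (All.map ≢-sym x≢))
  length-without {x} {y ∷ ys} (y≢ ∷ u) (there x∈) = trans (cong suc (length-without u x∈))
    (sym (cong (suc ∘′ length) kept))
    where
    kept : (y ∷ ys) without x ≡ y ∷ (ys without x)
    kept = filter-accept (differs? x) (All.lookup y≢ x∈)

  without-∉ : ∀ {x ys} → x ∉ ys → ys without x ≡ ys
  without-∉ {x} {ys} x∉ = filter-all (differs? x) (All.tabulate λ y∈ y≡x → x∉ (subst (_∈ ys) y≡x y∈))

  covers-∷⁺ : ∀ {n ys x} {v : Vec ℕ n} → Covers (ys without x) v → Covers ys (x ∷ v)
  covers-∷⁺ {x = x} c {y} y∈ with y ≟ x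
  ... | yes y≡x = zero , sym y≡x
  ... | no y≢x  = let i , e = c (∈-filter⁺ _ y∈ y≢x) in suc i , e

  covers-∷⁻ : ∀ {n ys x} {v : Vec ℕ n} → Covers ys (x ∷ v) → Covers (ys without x) v
  covers-∷⁻ {ys = ys} {x} c y∈ with ∈-filter⁻ (differs? x) {xs = ys} y∈
  ... | y∈ys , y≢x with c y∈ys
  ...   | zero  , e = contradiction (sym e) y≢x
  ...   | suc i , e = i , e

  -- By the first letter: one from `ys` is covered at once and turns optional, so `m` drops and `c`
  -- grows; any of the other `c` letters leaves the task for the remaining word unchanged.
  length-coverings : ∀ n c m {xs ys} → Unique xs → Unique ys → (∀ {y} → y ∈ ys → y ∈ xs) →
                     length ys ≡ m → length xs ≡ c + m → length (coverings xs ys n) ≡ words n c m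
  length-coverings zero c zero    {ys = []}     _ _ _ _ _ = refl
  length-coverings zero c (suc m) {ys = y ∷ ys} _ _ _ _ _ =
    cong length (filter-none (covers? (y ∷ ys)) {[] ∷ []} ((λ cov → Fin.¬Fin0 (proj₁ (cov {y} (here refl)))) ∷ []))
  length-coverings (suc n) c m {xs} {ys} ux uy sub lenys lenxs = begin
    length (coverings xs ys (suc n))
      ≡⟨ split xs ⟩
    length (filter (_∈? ys) xs) * hit m + length (filter (¬? ∘ (_∈? ys)) xs) * words n c m
      ≡⟨ cong₂ (λ a b → a * hit m + b * words n c m)
           (trans (length-filter-∈ ux uy sub) lenys) missed ⟩
    m * hit m + c * words n c m
      ≡⟨ combine m ⟩
    words (suc n) c m ∎
    where
    open ≡-Reasoning

    -- The count after an obligatory first letter. The value at 0 is a default: then `ys` is empty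
    -- and the factor in front of it is 0.
    hit : ℕ → ℕ
    hit zero    = 0
    hit (suc m) = words n (suc c) m

    combine : ∀ m → m * hit m + c * words n c m ≡ words (suc n) c m
    combine zero    = refl
    combine (suc m) = refl

    filters : ∀ zs → length (filter (_∈? ys) zs) + length (filter (¬? ∘ (_∈? ys)) zs) ≡ length zs
    filters [] = refl
    filters (z ∷ zs) with z ∈? ys
    ... | yes _ = cong suc (filters zs)
    ... | no _  = trans (+-suc _ _) (cong suc (filters zs))

    missed : length (filter (¬? ∘ (_∈? ys)) xs) ≡ c
    missed = +-cancelˡ-≡ m _ _ (trans
      (cong (_+ _) (sym (trans (length-filter-∈ ux uy sub) lenys)))
      (trans (filters xs) (trans lenxs (+-comm c m))))

    first : ∀ x → length (filter (covers? ys) (map (x ∷_) (allVecs xs n)))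
                ≡ length (coverings xs (ys without x) n)
    first x = trans (length-filter-map (covers? ys) (x ∷_) (allVecs xs n))
      (cong length (filter-≐ (covers? ys ∘ (x ∷_)) (covers? (ys without x)) (covers-∷⁻ , covers-∷⁺) (allVecs xs n)))

    unique-without : ∀ x → Unique (ys without x)
    unique-without x = Unique.filter⁺ (differs? x) uy

    sub-without : ∀ {x y} → y ∈ ys without x → y ∈ xs
    sub-without y∈ = sub (proj₁ (∈-filter⁻ (differs? _) {xs = ys} y∈))

    first-∈ : ∀ {x} → x ∈ ys → ∀ m → length ys ≡ m → length xs ≡ c + m →
              length (coverings xs (ys without x) n) ≡ hit m
    first-∈ x∈ zero e _ = contradiction (trans (sym (length-without uy x∈)) e) λ ()
    first-∈ {x} x∈ (suc m) e e′ = length-coverings n (suc c) m ux (unique-without x) sub-without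
      (suc-injective (trans (sym (length-without uy x∈)) e)) (trans e′ (+-suc c m))

    first-∉ : ∀ {x} → x ∉ ys → length (coverings xs (ys without x) n) ≡ words n c m
    first-∉ x∉ rewrite without-∉ x∉ = length-coverings n c m ux uy sub lenys lenxs

    -- Only the list of candidate first letters shrinks in the induction; the alphabet of the
    -- remaining word stays `xs`.
    split : ∀ zs →
            length (filter (covers? ys) (cartesianProductWith _∷_ zs (allVecs xs n)))
          ≡ length (filter (_∈? ys) zs) * hit m + length (filter (¬? ∘ (_∈? ys)) zs) * words n c m
    split [] = refl
    split (z ∷ zs)
      rewrite filter-++ (covers? ys) (map (z ∷_) (allVecs xs n)) (cartesianProductWith _∷_ zs (allVecs xs n))
            | length-++ (filter (covers? ys) (map (z ∷_) (allVecs xs n)))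
                {filter (covers? ys) (cartesianProductWith _∷_ zs (allVecs xs n))}
            | first z | split zs
      with z ∈? ys
    ... | yes z∈ rewrite first-∈ z∈ m lenys lenxs = sym (+-assoc (hit m) _ _)
    ... | no z∉  rewrite first-∉ z∉ = swap (words n c m) (length (filter (_∈? ys) zs) * hit m) _
      where
      swap : ∀ a b d → a + (b + d) ≡ b + (a + d)
      swap = solve-∀

  ∈-allVecs⁺ : ∀ {A : Set} {xs : List A} {n} {v : Vec A n} → (∀ i → lookup v i ∈ xs) → v ∈ allVecs xs n
  ∈-allVecs⁺ {v = []}    _   = here refl
  ∈-allVecs⁺ {v = x ∷ v} all∈ = ∈-cartesianProductWith⁺ _∷_ (all∈ zero) (∈-allVecs⁺ (all∈ ∘ suc))

  ∈-allVecs⁻ : ∀ {A : Set} (xs : List A) {n} {v : Vec A n} → v ∈ allVecs xs n → ∀ i → lookup v i ∈ xs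
  ∈-allVecs⁻ xs {suc n} v∈ i with ∈-cartesianProductWith⁻ _∷_ xs (allVecs xs n) v∈
  ∈-allVecs⁻ xs {suc n} v∈ zero    | _ , _ , x∈ , _  , refl = x∈
  ∈-allVecs⁻ xs {suc n} v∈ (suc i) | _ , _ , _  , w∈ , refl = ∈-allVecs⁻ xs w∈ i

  allVecs-unique : ∀ {A : Set} {xs : List A} → Unique xs → ∀ n → Unique (allVecs xs n)
  allVecs-unique u zero    = [] ∷ []
  allVecs-unique u (suc n) = Unique.cartesianProductWith⁺ _∷_ ∷-injective u (allVecs-unique u n)

  -- Levels, and the number of orientations with a given longest path.

  levels : Bool → ℕ → List ℕ
  levels true  zero    = 0 ∷ []
  levels false zero    = []
  levels true  (suc ℓ) = 0 ∷ map suc (levels false ℓ)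
  levels false (suc ℓ) = map suc (levels true ℓ)

  -- In closed form ⌊ℓ/2⌋ + 1 for `true` and ⌈ℓ/2⌉ for `false`; the recursion follows `levels`,
  -- where a shift by one exchanges the parities.
  blocks : Bool → ℕ → ℕ
  blocks true  zero    = 1
  blocks false zero    = 0
  blocks true  (suc ℓ) = suc (blocks false ℓ)
  blocks false (suc ℓ) = blocks true ℓ

  length-levels : ∀ b ℓ → length (levels b ℓ) ≡ blocks b ℓ
  length-levels true  zero    = refl
  length-levels false zero    = refl
  length-levels true  (suc ℓ) = cong suc (trans (length-map suc (levels false ℓ)) (length-levels false ℓ))
  length-levels false (suc ℓ) = trans (length-map suc (levels true ℓ)) (length-levels true ℓ)

  levels-unique : ∀ b ℓ → Unique (levels b ℓ)
  levels-unique true  zero    = [] ∷ []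
  levels-unique false zero    = []
  levels-unique true  (suc ℓ) =
    All.tabulate (λ l∈ 0≡l → 0≢1+n (trans 0≡l (proj₂ (proj₂ (∈-map⁻ suc l∈)))))
    ∷ Unique.map⁺ suc-injective (levels-unique false ℓ)
  levels-unique false (suc ℓ) = Unique.map⁺ suc-injective (levels-unique true ℓ)

  ∈-levels⁺ : ∀ {b ℓ l} → l ≤ ℓ → even l ≡ b → l ∈ levels b ℓ
  ∈-levels⁺ {true}  {zero}  z≤n _ = here refl
  ∈-levels⁺ {true}  {suc ℓ} {zero}  _ _ = here refl
  ∈-levels⁺ {true}  {suc ℓ} {suc l} (s≤s le) e = there (∈-map⁺ suc (∈-levels⁺ le (not-injective e)))
  ∈-levels⁺ {false} {suc ℓ} {suc l} (s≤s le) e = ∈-map⁺ suc (∈-levels⁺ le (not-injective e))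

  ∈-levels⁻ : ∀ b ℓ {l} → l ∈ levels b ℓ → l ≤ ℓ × even l ≡ b
  ∈-levels⁻ true  zero    (here refl) = z≤n , refl
  ∈-levels⁻ true  (suc ℓ) (here refl) = z≤n , refl
  ∈-levels⁻ true  (suc ℓ) (there l∈) with ∈-map⁻ suc l∈
  ... | _ , l′∈ , refl = let le , e = ∈-levels⁻ false ℓ l′∈ in s≤s le , cong not e
  ∈-levels⁻ false (suc ℓ) l∈ with ∈-map⁻ suc l∈
  ... | _ , l′∈ , refl = let le , e = ∈-levels⁻ true ℓ l′∈ in s≤s le , cong not e

  labellings : Bool → ℕ → ∀ n → List (Vec ℕ n)
  labellings b ℓ = coverings (levels b ℓ) (levels b ℓ)

  ∈-labellings⁺ : ∀ {b ℓ n} {v : Vec ℕ n} → Onto b ℓ (lookup v) → v ∈ labellings b ℓ n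
  ∈-labellings⁺ {b} {ℓ} (within , onto) = ∈-filter⁺ (covers? (levels b ℓ))
    (∈-allVecs⁺ (λ i → let le , e = within i in ∈-levels⁺ le e))
    (λ l∈ → let le , e = ∈-levels⁻ b ℓ l∈ in onto le e)

  ∈-labellings⁻ : ∀ b ℓ {n} {v : Vec ℕ n} → v ∈ labellings b ℓ n → Onto b ℓ (lookup v)
  ∈-labellings⁻ b ℓ {n} v∈ with ∈-filter⁻ (covers? (levels b ℓ)) {xs = allVecs (levels b ℓ) n} v∈
  ... | v∈all , cov =
    (λ i → ∈-levels⁻ b ℓ (∈-allVecs⁻ (levels b ℓ) v∈all i)) , (λ le e → cov (∈-levels⁺ le e))

  length-labellings : ∀ b ℓ n → length (labellings b ℓ n) ≡ surjections n (blocks b ℓ)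
  length-labellings b ℓ n = length-coverings n 0 (blocks b ℓ) (levels-unique b ℓ) (levels-unique b ℓ)
    (λ l∈ → l∈) (length-levels b ℓ) (length-levels b ℓ)

  labellings-unique : ∀ b ℓ n → Unique (labellings b ℓ n)
  labellings-unique b ℓ n = Unique.filter⁺ (covers? (levels b ℓ)) (allVecs-unique (levels-unique b ℓ) n)

  module _ (n k ℓ : ℕ) where

    codes : Bool → List (Vec ℕ n × Vec ℕ k)
    codes s = cartesianProduct (labellings s ℓ n) (labellings (not s) ℓ k)

    ∈-codes⁻ : ∀ s {f g} → (f , g) ∈ codes s → Onto s ℓ (lookup f) × Onto (not s) ℓ (lookup g)
    ∈-codes⁻ s c∈ with ∈-cartesianProduct⁻ (labellings s ℓ n) (labellings (not s) ℓ k) c∈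
    ... | f∈ , g∈ = ∈-labellings⁻ s ℓ f∈ , ∈-labellings⁻ (not s) ℓ g∈

    codes-unique : ∀ s → Unique (codes s)
    codes-unique s = Unique.cartesianProduct⁺ (labellings-unique s ℓ n) (labellings-unique (not s) ℓ k)

    allCodes : List (Vec ℕ n × Vec ℕ k)
    allCodes = codes true ++ codes false

    -- Level 0 always exists and is even: a code in `codes true` attains it on the left, where a
    -- code in `codes false` has only odd values.
    allCodes-unique : Unique allCodes
    allCodes-unique = Unique.++⁺ (codes-unique true) (codes-unique false) disjoint
      where
      disjoint : ∀ {c} → ¬ (c ∈ codes true × c ∈ codes false)
      disjoint (c∈ , c∈′) with ∈-codes⁻ true c∈ | ∈-codes⁻ false c∈′
      ... | (within , onto) , _ | (within′ , _) , _ with onto z≤n refl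
      ...   | i , _ = contradiction (trans (sym (proj₂ (within i))) (proj₂ (within′ i))) λ ()

    ∈-allCodes⁻ : ∀ {f g} → (f , g) ∈ allCodes →
                  ∃ λ s → Onto s ℓ (lookup f) × Onto (not s) ℓ (lookup g)
    ∈-allCodes⁻ c∈ with ∈-++⁻ (codes true) c∈
    ... | inj₁ p = true , ∈-codes⁻ true p
    ... | inj₂ p = false , ∈-codes⁻ false p

    ∈-allCodes⁺ : ∀ s {f g} → Onto s ℓ (lookup f) → Onto (not s) ℓ (lookup g) → (f , g) ∈ allCodes
    ∈-allCodes⁺ true  L R = ∈-++⁺ˡ (∈-cartesianProduct⁺ (∈-labellings⁺ L) (∈-labellings⁺ R))
    ∈-allCodes⁺ false L R =
      ∈-++⁺ʳ (codes true) (∈-cartesianProduct⁺ (∈-labellings⁺ L) (∈-labellings⁺ R))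

    alternating : ℕ
    alternating = surjections n (blocks true ℓ) * surjections k (blocks false ℓ)
                + surjections n (blocks false ℓ) * surjections k (blocks true ℓ)

    length-codes : ∀ s → length (codes s) ≡ surjections n (blocks s ℓ) * surjections k (blocks (not s) ℓ)
    length-codes s = trans (length-cartesianProduct (labellings s ℓ n) (labellings (not s) ℓ k))
      (cong₂ _*_ (length-labellings s ℓ n) (length-labellings (not s) ℓ k))

    length-allCodes : length allCodes ≡ alternating
    length-allCodes = trans (length-++ (codes true)) (cong₂ _+_ (length-codes true) (length-codes false))

    level : Vec ℕ n × Vec ℕ k → Vertex n k → ℕ
    level (f , g) = [ lookup f , lookup g ]′

    allOrientations-unique : Unique (allOrientations n k)
    allOrientations-unique = allVecs-unique (allVecs-unique (((λ ()) ∷ []) ∷ ([] ∷ [])) k) n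

    ∈-allOrientations : ∀ o → o ∈ allOrientations n k
    ∈-allOrientations o = ∈-allVecs⁺ λ i → ∈-allVecs⁺ λ j → bool (lookup (lookup o i) j)
      where
      bool : ∀ b → b ∈ true ∷ false ∷ []
      bool true  = here refl
      bool false = there (here refl)

    counted? : Decidable (λ (o : Orientation n k) → Acyclic o × LongestPath o ℓ)
    counted? o = acyclic? o ×-dec longestPath? o ℓ

    -- Two applications of the pigeonhole principle to the same relation: an orientation determines
    -- its heights, and the heights determine the orientation.
    G-nonempty : Vertex n k → G n k ℓ ≡ alternating
    G-nonempty v = trans (≤-antisym
      (length-≤ Coded orientation-unique (Unique.filter⁺ counted? allOrientations-unique) encode)
      (length-≤ (λ c o → Coded o c) code-unique allCodes-unique decode)) length-allCodes
      where
      Coded : Orientation n k → Vec ℕ n × Vec ℕ k → Set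
      Coded o c = IsHeight o (level c)

      code-unique : ∀ {c c′ o} → Coded o c → Coded o c′ → c ≡ c′
      code-unique H H′ = cong₂ _,_
        (lookup-ext (λ i → height-unique H H′ (inj₁ i))) (lookup-ext (λ j → height-unique H H′ (inj₂ j)))

      encode : ∀ {o} → o ∈ filter counted? (allOrientations n k) → ∃ λ c → c ∈ allCodes × Coded o c
      encode {o} o∈ with ∈-filter⁻ counted? {xs = allOrientations n k} o∈
      ... | _ , ac , long with acyclic⇒height o ac
      ...   | h , H =
        c , ∈-allCodes⁺ (colour H′ v) L R , H′
        where
        -- Heights are stored in vectors, which are equal as soon as their entries agree.
        c = tabulate (h ∘ inj₁) , tabulate (h ∘ inj₂)
        same : ∀ v → level c v ≡ h v
        same (inj₁ i) = lookup∘tabulate _ i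
        same (inj₂ j) = lookup∘tabulate _ j
        H′ : Coded o c
        H′ = IsHeight-resp same H
        L = proj₁ (height⇒levels H′ long v)
        R = proj₂ (height⇒levels H′ long v)

      decode : ∀ {c} → c ∈ allCodes → ∃ λ o → o ∈ filter counted? (allOrientations n k) × Coded o c
      decode c∈ with ∈-allCodes⁻ c∈
      ... | s , L , R with levels⇒height L R
      ...   | o , H = o , ∈-filter⁺ counted? (∈-allOrientations o)
                            (height⇒acyclic H , levels⇒longest L R H) , H

  -- The empty graph has an acyclic orientation but no block.
  emptyGraph : ℕ → ℕ → ℕ → ℕ
  emptyGraph 0 0 0 = 1
  emptyGraph _ _ _ = 0

  G-formula : ∀ n k ℓ → G n k ℓ ≡ emptyGraph n k ℓ + alternating n k ℓ
  G-formula (suc n) k       ℓ       = G-nonempty (suc n) k ℓ (inj₁ zero)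
  G-formula zero    (suc k) ℓ       = G-nonempty zero (suc k) ℓ (inj₂ zero)
  -- Without vertices both summands of `alternating` vanish, since some side would have to attain
  -- level 0; the single empty orientation is supplied by `emptyGraph`.
  G-formula zero    zero    zero    = refl
  G-formula zero    zero    (suc ℓ) = sym (*-zeroʳ (surjections 0 (blocks true ℓ)))

open import Defs
open Counting using (surjections; surjections-suc; blocks; emptyGraph; G-formula)
open import Data.Bool using (true; false)
open import Data.Integer using (+_)
import Data.Integer.Properties as ℤ
import Data.Integer as ℤ
open import Data.Nat using (ℕ; zero; suc; _∸_; _≤_; _!; z≤n; s≤s)
import Data.Nat as ℕ
import Data.Nat.Properties as ℕ
open import Data.Product using (_,_)
open import Data.Rational using (ℚ; 0ℚ; 1ℚ; _/_)
import Data.Rational as ℚ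
import Data.Rational.Properties as ℚ
open import Data.Rational.Solver using (module +-*-Solver)
import Data.Rational.Unnormalised as ℚᵘ
import Data.Rational.Unnormalised.Properties as ℚᵘ
open import Relation.Binary.PropositionalEquality
open +-*-Solver using (solve; _:+_; _:*_; _:-_; _:=_; con)
open ≡-Reasoning

-- Natural numbers and inverse factorials in the rationals.

⟦_⟧ : ℕ → ℚ
⟦ m ⟧ = + m / 1

⟦⟧-+ : ∀ m n → ⟦ m ℕ.+ n ⟧ ≡ ⟦ m ⟧ ℚ.+ ⟦ n ⟧
⟦⟧-+ m n = ℚ.toℚᵘ-injective (ℚᵘ.≃-trans (ℚ.toℚᵘ-fromℚᵘ (ℚᵘ.mkℚᵘ (+ (m ℕ.+ n)) 0)) (ℚᵘ.≃-sym
  (ℚᵘ.≃-trans (ℚ.toℚᵘ-homo-+ ⟦ m ⟧ ⟦ n ⟧) (ℚᵘ.≃-trans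
    (ℚᵘ.+-cong (ℚ.toℚᵘ-fromℚᵘ (ℚᵘ.mkℚᵘ (+ m) 0)) (ℚ.toℚᵘ-fromℚᵘ (ℚᵘ.mkℚᵘ (+ n) 0)))
    (ℚᵘ.*≡* (cong (ℤ._* + 1) (cong₂ ℤ._+_ (ℤ.*-identityʳ (+ m)) (ℤ.*-identityʳ (+ n)))))))))

⟦⟧-* : ∀ m n → ⟦ m ℕ.* n ⟧ ≡ ⟦ m ⟧ ℚ.* ⟦ n ⟧
⟦⟧-* zero    n = sym (ℚ.*-zeroˡ ⟦ n ⟧)
⟦⟧-* (suc m) n = begin
  ⟦ n ℕ.+ m ℕ.* n ⟧             ≡⟨ ⟦⟧-+ n (m ℕ.* n) ⟩
  ⟦ n ⟧ ℚ.+ ⟦ m ℕ.* n ⟧         ≡⟨ cong (⟦ n ⟧ ℚ.+_) (⟦⟧-* m n) ⟩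
  ⟦ n ⟧ ℚ.+ ⟦ m ⟧ ℚ.* ⟦ n ⟧     ≡⟨ solve 2 (λ a b → b :+ a :* b := (con 1ℚ :+ a) :* b) refl ⟦ m ⟧ ⟦ n ⟧ ⟩
  (1ℚ ℚ.+ ⟦ m ⟧) ℚ.* ⟦ n ⟧      ≡⟨ cong (ℚ._* ⟦ n ⟧) (sym (⟦⟧-+ 1 m)) ⟩
  ⟦ suc m ⟧ ℚ.* ⟦ n ⟧           ∎

⟦⟧-inverse : ∀ d .⦃ _ : ℕ.NonZero d ⦄ → ⟦ d ⟧ ℚ.* (+ 1 / d) ≡ 1ℚ
⟦⟧-inverse (suc d) = ℚ.toℚᵘ-injective (ℚᵘ.≃-trans (ℚ.toℚᵘ-homo-* ⟦ suc d ⟧ (+ 1 / suc d)) (ℚᵘ.≃-trans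
  (ℚᵘ.*-cong (ℚ.toℚᵘ-fromℚᵘ (ℚᵘ.mkℚᵘ (+ suc d) 0)) (ℚ.toℚᵘ-fromℚᵘ (ℚᵘ.mkℚᵘ (+ 1) d)))
  (ℚᵘ.*≡* (trans (ℤ.*-identityʳ _) (trans (ℤ.*-comm (+ suc d) (+ 1)) (cong (λ e → + 1 ℤ.* + suc e) (sym (ℕ.+-identityʳ d))))))))

⟦⟧-cancelˡ : ∀ n {p q} → ⟦ suc n ⟧ ℚ.* p ≡ ⟦ suc n ⟧ ℚ.* q → p ≡ q
⟦⟧-cancelˡ n {p} {q} e = trans (recover p) (trans (cong (r ℚ.*_) e) (sym (recover q)))
  where
  r = + 1 / suc n
  recover : ∀ p → p ≡ r ℚ.* (⟦ suc n ⟧ ℚ.* p)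
  recover p = begin
    p                          ≡⟨ sym (ℚ.*-identityˡ p) ⟩
    1ℚ ℚ.* p                   ≡⟨ cong (ℚ._* p) (sym (⟦⟧-inverse (suc n))) ⟩
    ⟦ suc n ⟧ ℚ.* r ℚ.* p      ≡⟨ solve 3 (λ a b c → a :* b :* c := b :* (a :* c)) refl ⟦ suc n ⟧ r p ⟩
    r ℚ.* (⟦ suc n ⟧ ℚ.* p)    ∎

-- The coefficient form of (e^t)′ = e^t.
1/!-suc : ∀ n → ⟦ suc n ⟧ ℚ.* 1/ suc n ! ≡ 1/ n !
1/!-suc n = sym (begin
  1/ n !
    ≡⟨ sym (ℚ.*-identityʳ _) ⟩
  1/ n ! ℚ.* 1ℚ
    ≡⟨ cong (1/ n ! ℚ.*_) (sym (⟦⟧-inverse (suc n !) ⦃ suc n ℕ.!≢0 ⦄)) ⟩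
  1/ n ! ℚ.* (⟦ suc n ! ⟧ ℚ.* 1/ suc n !)
    ≡⟨ cong (λ z → 1/ n ! ℚ.* (z ℚ.* 1/ suc n !)) (⟦⟧-* (suc n) (n !)) ⟩
  1/ n ! ℚ.* (⟦ suc n ⟧ ℚ.* ⟦ n ! ⟧ ℚ.* 1/ suc n !)
    ≡⟨ solve 4 (λ a b c d → a :* (b :* c :* d) := c :* a :* (b :* d)) refl (1/ n !) ⟦ suc n ⟧ ⟦ n ! ⟧ (1/ suc n !) ⟩
  ⟦ n ! ⟧ ℚ.* 1/ n ! ℚ.* (⟦ suc n ⟧ ℚ.* 1/ suc n !)
    ≡⟨ cong (ℚ._* (⟦ suc n ⟧ ℚ.* 1/ suc n !)) (⟦⟧-inverse (n !) ⦃ n ℕ.!≢0 ⦄) ⟩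
  1ℚ ℚ.* (⟦ suc n ⟧ ℚ.* 1/ suc n !)
    ≡⟨ ℚ.*-identityˡ _ ⟩
  ⟦ suc n ⟧ ℚ.* 1/ suc n ! ∎)

-- Finite sums and the Kronecker delta.

∑-cong≤ : ∀ n {f g : ℕ → ℚ} → (∀ i → i ≤ n → f i ≡ g i) → ∑≤ n f ≡ ∑≤ n g
∑-cong≤ zero    e = e 0 z≤n
∑-cong≤ (suc n) e = cong₂ ℚ._+_ (∑-cong≤ n (λ i i≤n → e i (ℕ.m≤n⇒m≤1+n i≤n))) (e (suc n) ℕ.≤-refl)

∑-cong : ∀ n {f g : ℕ → ℚ} → (∀ i → f i ≡ g i) → ∑≤ n f ≡ ∑≤ n g
∑-cong n e = ∑-cong≤ n (λ i _ → e i)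

∑-0 : ∀ n → ∑≤ n (λ _ → 0ℚ) ≡ 0ℚ
∑-0 zero    = refl
∑-0 (suc n) = cong (ℚ._+ 0ℚ) (∑-0 n)

∑-+ : ∀ n (f g : ℕ → ℚ) → ∑≤ n (λ i → f i ℚ.+ g i) ≡ ∑≤ n f ℚ.+ ∑≤ n g
∑-+ zero    f g = refl
∑-+ (suc n) f g = trans (cong (ℚ._+ (f (suc n) ℚ.+ g (suc n))) (∑-+ n f g))
  (solve 4 (λ a b c d → (a :+ b) :+ (c :+ d) := (a :+ c) :+ (b :+ d)) refl (∑≤ n f) (∑≤ n g) (f (suc n)) (g (suc n)))

∑-*ˡ : ∀ n c (f : ℕ → ℚ) → ∑≤ n (λ i → c ℚ.* f i) ≡ c ℚ.* ∑≤ n f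
∑-*ˡ zero    c f = refl
∑-*ˡ (suc n) c f = trans (cong (ℚ._+ c ℚ.* f (suc n)) (∑-*ˡ n c f)) (sym (ℚ.*-distribˡ-+ c _ _))

∑-*ʳ : ∀ n c (f : ℕ → ℚ) → ∑≤ n (λ i → f i ℚ.* c) ≡ ∑≤ n f ℚ.* c
∑-*ʳ n c f = trans (∑-cong n (λ i → ℚ.*-comm (f i) c)) (trans (∑-*ˡ n c f) (ℚ.*-comm c _))

∑-swap : ∀ m n (f : ℕ → ℕ → ℚ) → ∑≤ m (λ i → ∑≤ n (f i)) ≡ ∑≤ n (λ j → ∑≤ m (λ i → f i j))
∑-swap zero    n f = refl
∑-swap (suc m) n f = trans (cong (ℚ._+ ∑≤ n (f (suc m))) (∑-swap m n f)) (sym (∑-+ n _ _))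

∑-suc : ∀ n (f : ℕ → ℚ) → ∑≤ (suc n) f ≡ f 0 ℚ.+ ∑≤ n (λ i → f (suc i))
∑-suc zero    f = refl
∑-suc (suc n) f = trans (cong (ℚ._+ f (suc (suc n))) (∑-suc n f)) (ℚ.+-assoc (f 0) _ _)

∑-first : ∀ n {f : ℕ → ℚ} → (∀ i → f (suc i) ≡ 0ℚ) → ∑≤ n f ≡ f 0
∑-first zero    _ = refl
∑-first (suc n) e = trans (cong₂ ℚ._+_ (∑-first n e) (e n)) (ℚ.+-identityʳ _)

∑-vanish : ∀ n {f : ℕ → ℚ} → (∀ i → f i ≡ 0ℚ) → ∑≤ n f ≡ 0ℚ
∑-vanish n e = trans (∑-cong n e) (∑-0 n)

-- Read as a series in one variable, `dirac m` is the monomial t^m; in particular `dirac 0` is the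
-- constant 1.
dirac : ℕ → ℕ → ℚ
dirac zero    zero    = 1ℚ
dirac zero    (suc n) = 0ℚ
dirac (suc m) zero    = 0ℚ
dirac (suc m) (suc n) = dirac m n

dirac-sym : ∀ m n → dirac m n ≡ dirac n m
dirac-sym zero    zero    = refl
dirac-sym zero    (suc n) = refl
dirac-sym (suc m) zero    = refl
dirac-sym (suc m) (suc n) = dirac-sym m n

dirac-subst : ∀ m n (f : ℕ → ℚ) → dirac m n ℚ.* f m ≡ dirac m n ℚ.* f n
dirac-subst zero    zero    f = refl
dirac-subst zero    (suc n) f = trans (ℚ.*-zeroˡ (f 0)) (sym (ℚ.*-zeroˡ (f (suc n))))
dirac-subst (suc m) zero    f = trans (ℚ.*-zeroˡ (f (suc m))) (sym (ℚ.*-zeroˡ (f 0)))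
dirac-subst (suc m) (suc n) f = dirac-subst m n (λ i → f (suc i))

∑-dirac : ∀ {m n} → m ≤ n → (f : ℕ → ℚ) → ∑≤ n (λ i → dirac m i ℚ.* f i) ≡ f m
∑-dirac {n = n} z≤n f = trans (∑-first n (λ i → ℚ.*-zeroˡ (f (suc i)))) (ℚ.*-identityˡ (f 0))
∑-dirac {suc m} {suc n} (s≤s m≤n) f = begin
  ∑≤ (suc n) (λ i → dirac (suc m) i ℚ.* f i)
    ≡⟨ ∑-suc n _ ⟩
  0ℚ ℚ.* f 0 ℚ.+ ∑≤ n (λ i → dirac m i ℚ.* f (suc i))
    ≡⟨ cong₂ ℚ._+_ (ℚ.*-zeroˡ (f 0)) (∑-dirac m≤n (λ i → f (suc i))) ⟩
  0ℚ ℚ.+ f (suc m)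
    ≡⟨ ℚ.+-identityˡ _ ⟩
  f (suc m) ∎

-- One-variable series, and the generating function of surjections.

infixl 7 _⋆_

_⋆_ : (ℕ → ℚ) → (ℕ → ℚ) → ℕ → ℚ
(a ⋆ b) n = ∑≤ n λ i → a i ℚ.* b (n ∸ i)

⋆-cong : ∀ {a a′ b b′ : ℕ → ℚ} → (∀ n → a n ≡ a′ n) → (∀ n → b n ≡ b′ n) → ∀ n → (a ⋆ b) n ≡ (a′ ⋆ b′) n
⋆-cong e e′ n = ∑-cong n (λ i → cong₂ ℚ._*_ (e i) (e′ (n ∸ i)))

⋆-identityˡ : ∀ a n → (dirac 0 ⋆ a) n ≡ a n
⋆-identityˡ a n = ∑-dirac {n = n} z≤n (λ i → a (n ∸ i))

⋆-identityʳ : ∀ a n → (a ⋆ dirac 0) n ≡ a n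
⋆-identityʳ a n = trans
  (∑-cong≤ n (λ i i≤n → trans (ℚ.*-comm (a i) _) (cong (ℚ._* a i) (reflect i≤n))))
  (∑-dirac {n} ℕ.≤-refl a)
  where
  reflect : ∀ {i n} → i ≤ n → dirac 0 (n ∸ i) ≡ dirac n i
  reflect {n = n} z≤n = dirac-sym 0 n
  reflect (s≤s i≤n)   = reflect i≤n

⋆-zeroʳ : ∀ a n → (a ⋆ λ _ → 0ℚ) n ≡ 0ℚ
⋆-zeroʳ a n = ∑-vanish n (λ i → ℚ.*-zeroʳ (a i))

⋆-distribʳ : ∀ (a b c : ℕ → ℚ) n → ((λ i → a i ℚ.+ b i) ⋆ c) n ≡ (a ⋆ c) n ℚ.+ (b ⋆ c) n
⋆-distribʳ a b c n = trans (∑-cong n (λ i → ℚ.*-distribʳ-+ (c (n ∸ i)) (a i) (b i))) (∑-+ n _ _)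

⋆-distribˡ : ∀ (a b c : ℕ → ℚ) n → (a ⋆ λ i → b i ℚ.+ c i) n ≡ (a ⋆ b) n ℚ.+ (a ⋆ c) n
⋆-distribˡ a b c n = trans (∑-cong n (λ i → ℚ.*-distribˡ-+ (a i) _ _)) (∑-+ n _ _)

⋆-scaleʳ : ∀ c (a b : ℕ → ℚ) n → (a ⋆ λ i → c ℚ.* b i) n ≡ c ℚ.* (a ⋆ b) n
⋆-scaleʳ c a b n = trans
  (∑-cong n (λ i → solve 3 (λ x y z → x :* (y :* z) := y :* (x :* z)) refl (a i) c (b (n ∸ i))))
  (∑-*ˡ n c _)

∂ : (ℕ → ℚ) → ℕ → ℚ
∂ a n = ⟦ suc n ⟧ ℚ.* a (suc n)

-- In the term of index i the factor n + 1 splits as i + (n + 1 - i). Each half loses the boundary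
-- term in which its factor is 0, and the rest is a convolution of length n.
∂-⋆ : ∀ (a b : ℕ → ℚ) n → ∂ (a ⋆ b) n ≡ (∂ a ⋆ b) n ℚ.+ (a ⋆ ∂ b) n
∂-⋆ a b n = begin
  ⟦ suc n ⟧ ℚ.* ∑≤ (suc n) (λ i → a i ℚ.* b (suc n ∸ i))
    ≡⟨ sym (∑-*ˡ (suc n) ⟦ suc n ⟧ (λ i → a i ℚ.* b (suc n ∸ i))) ⟩
  ∑≤ (suc n) (λ i → ⟦ suc n ⟧ ℚ.* (a i ℚ.* b (suc n ∸ i)))
    ≡⟨ ∑-cong≤ (suc n) leibniz ⟩
  ∑≤ (suc n) (λ i → left i ℚ.+ right i)
    ≡⟨ ∑-+ (suc n) left right ⟩
  ∑≤ (suc n) left ℚ.+ ∑≤ (suc n) right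
    ≡⟨ cong₂ ℚ._+_ lefts rights ⟩
  (∂ a ⋆ b) n ℚ.+ (a ⋆ ∂ b) n ∎
  where
  left right : ℕ → ℚ
  left  i = ⟦ i ⟧ ℚ.* a i ℚ.* b (suc n ∸ i)
  right i = a i ℚ.* (⟦ suc n ∸ i ⟧ ℚ.* b (suc n ∸ i))

  leibniz : ∀ i → i ≤ suc n → ⟦ suc n ⟧ ℚ.* (a i ℚ.* b (suc n ∸ i)) ≡ left i ℚ.+ right i
  leibniz i i≤ = trans
    (cong (ℚ._* (a i ℚ.* b (suc n ∸ i))) (trans (cong ⟦_⟧ (sym (ℕ.m+[n∸m]≡n i≤))) (⟦⟧-+ i (suc n ∸ i))))
    (solve 4 (λ p q r s → (p :+ q) :* (r :* s) := p :* r :* s :+ r :* (q :* s)) refl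
      ⟦ i ⟧ ⟦ suc n ∸ i ⟧ (a i) (b (suc n ∸ i)))

  lefts : ∑≤ (suc n) left ≡ (∂ a ⋆ b) n
  lefts = trans (∑-suc n left) (trans
    (cong (ℚ._+ ∑≤ n (λ i → left (suc i)))
      (solve 2 (λ p q → con 0ℚ :* p :* q := con 0ℚ) refl (a 0) (b (suc n))))
    (ℚ.+-identityˡ _))

  rights : ∑≤ (suc n) right ≡ (a ⋆ ∂ b) n
  rights = trans (cong₂ ℚ._+_
    (∑-cong≤ n (λ i i≤n → cong (λ d → a i ℚ.* (⟦ d ⟧ ℚ.* b d)) (ℕ.+-∸-assoc 1 i≤n)))
    (trans (cong (λ d → a (suc n) ℚ.* (⟦ d ⟧ ℚ.* b d)) (ℕ.n∸n≡0 n))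
      (solve 2 (λ p q → p :* (con 0ℚ :* q) := con 0ℚ) refl (a (suc n)) (b 0))))
    (ℚ.+-identityʳ _)

e e-1 : ℕ → ℚ
e   n = 1/ n !
e-1 n = e n ℚ.- dirac 0 n

e≡1+e-1 : ∀ n → e n ≡ dirac 0 n ℚ.+ e-1 n
e≡1+e-1 n = solve 2 (λ a b → a := b :+ (a :- b)) refl (e n) (dirac 0 n)

power : ℕ → ℕ → ℚ
power zero    = dirac 0
power (suc m) = e-1 ⋆ power m

∂-e-1 : ∀ n → ∂ e-1 n ≡ dirac 0 n ℚ.+ e-1 n
∂-e-1 n = trans (cong (⟦ suc n ⟧ ℚ.*_) (ℚ.+-identityʳ (e (suc n)))) (trans (1/!-suc n) (e≡1+e-1 n))

-- The derivative of (e^t - 1)^(m+1) is (m + 1) e^t (e^t - 1)^m, and e^t = 1 + (e^t - 1) splits it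
-- into two powers.
∂-power : ∀ m n → ∂ (power (suc m)) n ≡ ⟦ suc m ⟧ ℚ.* (power m n ℚ.+ power (suc m) n)
∂-power m n = begin
  ∂ (e-1 ⋆ power m) n
    ≡⟨ ∂-⋆ e-1 (power m) n ⟩
  (∂ e-1 ⋆ power m) n ℚ.+ (e-1 ⋆ ∂ (power m)) n
    ≡⟨ cong₂ ℚ._+_ first (second m) ⟩
  s ℚ.+ ⟦ m ⟧ ℚ.* s
    ≡⟨ solve 2 (λ a b → b :+ a :* b := (con 1ℚ :+ a) :* b) refl ⟦ m ⟧ s ⟩
  (1ℚ ℚ.+ ⟦ m ⟧) ℚ.* s
    ≡⟨ cong (ℚ._* s) (sym (⟦⟧-+ 1 m)) ⟩
  ⟦ suc m ⟧ ℚ.* s ∎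
  where
  s = power m n ℚ.+ power (suc m) n

  first : (∂ e-1 ⋆ power m) n ≡ s
  first = trans (⋆-cong {b = power m} ∂-e-1 (λ _ → refl) n) (trans (⋆-distribʳ (dirac 0) e-1 (power m) n)
    (cong (ℚ._+ power (suc m) n) (⋆-identityˡ (power m) n)))

  second : ∀ m → (e-1 ⋆ ∂ (power m)) n ≡ ⟦ m ⟧ ℚ.* (power m n ℚ.+ power (suc m) n)
  second zero = trans (⋆-cong {a = e-1} (λ _ → refl) (λ i → ℚ.*-zeroʳ ⟦ suc i ⟧) n)
    (trans (⋆-zeroʳ e-1 n) (sym (ℚ.*-zeroˡ (power 0 n ℚ.+ power 1 n))))
  second (suc m) = trans (⋆-cong {a = e-1} (λ _ → refl) (∂-power m) n)
    (trans (⋆-scaleʳ ⟦ suc m ⟧ e-1 (λ i → power m i ℚ.+ power (suc m) i) n)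
      (cong (⟦ suc m ⟧ ℚ.*_) (⋆-distribˡ e-1 (power m) (power (suc m)) n)))

-- Up to the factor n + 1, `∂-power` and `surjections-suc` express the coefficient at n + 1 through
-- those at n in the same way. At n = 0 positive powers vanish, as e^t - 1 has constant term 0.
power-surjections : ∀ n m → power m n ≡ ⟦ surjections n m ⟧ ℚ.* e n
power-surjections zero    zero    = refl
power-surjections zero    (suc m) = trans (ℚ.*-zeroˡ (power m 0)) (sym (ℚ.*-zeroˡ (e 0)))
power-surjections (suc n) zero    = sym (ℚ.*-zeroˡ (e (suc n)))
power-surjections (suc n) (suc m) = ⟦⟧-cancelˡ n (begin
  ⟦ suc n ⟧ ℚ.* power (suc m) (suc n)
    ≡⟨ ∂-power m n ⟩
  ⟦ suc m ⟧ ℚ.* (power m n ℚ.+ power (suc m) n)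
    ≡⟨ cong (⟦ suc m ⟧ ℚ.*_) (cong₂ ℚ._+_ (power-surjections n m) (power-surjections n (suc m))) ⟩
  ⟦ suc m ⟧ ℚ.* (⟦ s ⟧ ℚ.* e n ℚ.+ ⟦ t ⟧ ℚ.* e n)
    ≡⟨ solve 4 (λ a b c d → a :* (b :* d :+ c :* d) := a :* (b :+ c) :* d) refl ⟦ suc m ⟧ ⟦ s ⟧ ⟦ t ⟧ (e n) ⟩
  ⟦ suc m ⟧ ℚ.* (⟦ s ⟧ ℚ.+ ⟦ t ⟧) ℚ.* e n
    ≡⟨ cong₂ ℚ._*_ collect (sym (1/!-suc n)) ⟩
  ⟦ r ⟧ ℚ.* (⟦ suc n ⟧ ℚ.* e (suc n))
    ≡⟨ solve 3 (λ a b c → a :* (b :* c) := b :* (a :* c)) refl ⟦ r ⟧ ⟦ suc n ⟧ (e (suc n)) ⟩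
  ⟦ suc n ⟧ ℚ.* (⟦ r ⟧ ℚ.* e (suc n)) ∎)
  where
  r = surjections (suc n) (suc m)
  s = surjections n m
  t = surjections n (suc m)

  collect : ⟦ suc m ⟧ ℚ.* (⟦ s ⟧ ℚ.+ ⟦ t ⟧) ≡ ⟦ r ⟧
  collect = begin
    ⟦ suc m ⟧ ℚ.* (⟦ s ⟧ ℚ.+ ⟦ t ⟧)   ≡⟨ cong (⟦ suc m ⟧ ℚ.*_) (sym (⟦⟧-+ s t)) ⟩
    ⟦ suc m ⟧ ℚ.* ⟦ s ℕ.+ t ⟧         ≡⟨ sym (⟦⟧-* (suc m) (s ℕ.+ t)) ⟩
    ⟦ suc m ℕ.* (s ℕ.+ t) ⟧           ≡⟨ cong ⟦_⟧ (sym (surjections-suc n m)) ⟩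
    ⟦ r ⟧                             ∎

-- Products of three-variable series by shape.

≈-sym : ∀ {A B} → A ≈ B → B ≈ A
≈-sym p n k ℓ = sym (p n k ℓ)

≈-trans : ∀ {A B C} → A ≈ B → B ≈ C → A ≈ C
≈-trans p q n k ℓ = trans (p n k ℓ) (q n k ℓ)

minus-cong : ∀ {A A′ B B′} → A ≈ A′ → B ≈ B′ → A - B ≈ A′ - B′
minus-cong p q n k ℓ = cong₂ ℚ._-_ (p n k ℓ) (q n k ℓ)

*-cong : ∀ {A A′ B B′} → A ≈ A′ → B ≈ B′ → A * B ≈ A′ * B′
*-cong p q n k ℓ = ∑-cong n λ a → ∑-cong k λ b → ∑-cong ℓ λ c → cong₂ ℚ._*_ (p a b c) (q _ _ _)

∑³ : ℕ → ℕ → ℕ → Series → ℚ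
∑³ n k ℓ f = ∑≤ n λ a → ∑≤ k λ b → ∑≤ ℓ λ c → f a b c

∑³-+ : ∀ n k ℓ f g → ∑³ n k ℓ (f + g) ≡ ∑³ n k ℓ f ℚ.+ ∑³ n k ℓ g
∑³-+ n k ℓ f g = trans (∑-cong n λ a → trans (∑-cong k λ b → ∑-+ ℓ (f a b) (g a b)) (∑-+ k _ _)) (∑-+ n _ _)

*-distribʳ-+ : ∀ A B C → (A + B) * C ≈ A * C + B * C
*-distribʳ-+ A B C n k ℓ = trans
  (∑-cong n λ a → ∑-cong k λ b → ∑-cong ℓ λ c →
    ℚ.*-distribʳ-+ (C (n ∸ a) (k ∸ b) (ℓ ∸ c)) (A a b c) (B a b c))
  (∑³-+ n k ℓ (λ a b c → A a b c ℚ.* C (n ∸ a) (k ∸ b) (ℓ ∸ c))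
              (λ a b c → B a b c ℚ.* C (n ∸ a) (k ∸ b) (ℓ ∸ c)))

*-distribʳ-minus : ∀ A B C → (A - B) * C ≈ A * C - B * C
*-distribʳ-minus A B C n k ℓ = trans (sym (cancel (((A - B) * C) n k ℓ) ((B * C) n k ℓ))) (cong (ℚ._- (B * C) n k ℓ)
  (trans (sym (*-distribʳ-+ (A - B) B C n k ℓ)) (*-cong {B = C} restore (λ _ _ _ → refl) n k ℓ)))
  where
  restore : (A - B) + B ≈ A
  restore n k ℓ = solve 2 (λ p q → (p :- q) :+ q := p) refl (A n k ℓ) (B n k ℓ)
  cancel : ∀ p q → (p ℚ.+ q) ℚ.- q ≡ p
  cancel = solve 2 (λ p q → (p :+ q) :- q := p) refl

-- The x and y factors may vary with the power of u, which accommodates the inverse of the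
-- denominator.
sliced : (ℕ → ℕ → ℚ) → (ℕ → ℕ → ℚ) → Series
sliced P Q n k ℓ = P ℓ n ℚ.* Q ℓ k

separable : (ℕ → ℚ) → (ℕ → ℚ) → (ℕ → ℚ) → Series
separable a b c n k ℓ = c ℓ ℚ.* (a n ℚ.* b k)

-- With the sum over powers of u moved outermost, the remaining double sum factors into a
-- convolution in x and one in y.
separable-*-sliced : ∀ a b c P Q n k ℓ → (separable a b c * sliced P Q) n k ℓ
                   ≡ ∑≤ ℓ λ l → c l ℚ.* ((a ⋆ P (ℓ ∸ l)) n ℚ.* (b ⋆ Q (ℓ ∸ l)) k)
separable-*-sliced a b c P Q n k ℓ = begin
  (∑≤ n λ i → ∑≤ k λ j → ∑≤ ℓ λ l → c l ℚ.* (a i ℚ.* b j) ℚ.* (P (ℓ ∸ l) (n ∸ i) ℚ.* Q (ℓ ∸ l) (k ∸ j)))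
    ≡⟨ (∑-cong n λ i → ∑-cong k λ j → ∑-cong ℓ λ l →
          solve 5 (λ a b c p q → c :* (a :* b) :* (p :* q) := c :* (a :* p :* (b :* q))) refl
            (a i) (b j) (c l) (P (ℓ ∸ l) (n ∸ i)) (Q (ℓ ∸ l) (k ∸ j))) ⟩
  (∑≤ n λ i → ∑≤ k λ j → ∑≤ ℓ λ l → c l ℚ.* (f l i ℚ.* g l j))
    ≡⟨ (∑-cong n λ i → ∑-swap k ℓ λ j l → c l ℚ.* (f l i ℚ.* g l j)) ⟩
  (∑≤ n λ i → ∑≤ ℓ λ l → ∑≤ k λ j → c l ℚ.* (f l i ℚ.* g l j))
    ≡⟨ (∑-swap n ℓ λ i l → ∑≤ k λ j → c l ℚ.* (f l i ℚ.* g l j)) ⟩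
  (∑≤ ℓ λ l → ∑≤ n λ i → ∑≤ k λ j → c l ℚ.* (f l i ℚ.* g l j))
    ≡⟨ (∑-cong ℓ λ l → ∑-cong n λ i → trans (∑-*ˡ k (c l) λ j → f l i ℚ.* g l j)
          (cong (c l ℚ.*_) (∑-*ˡ k (f l i) (g l)))) ⟩
  (∑≤ ℓ λ l → ∑≤ n λ i → c l ℚ.* (f l i ℚ.* ∑≤ k (g l)))
    ≡⟨ (∑-cong ℓ λ l → trans (∑-*ˡ n (c l) λ i → f l i ℚ.* ∑≤ k (g l))
          (cong (c l ℚ.*_) (∑-*ʳ n (∑≤ k (g l)) (f l)))) ⟩
  (∑≤ ℓ λ l → c l ℚ.* (∑≤ n (f l) ℚ.* ∑≤ k (g l))) ∎
  where
  f g : ℕ → ℕ → ℚ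
  f l i = a i ℚ.* P (ℓ ∸ l) (n ∸ i)
  g l j = b j ℚ.* Q (ℓ ∸ l) (k ∸ j)

separable-* : ∀ a b c a′ b′ c′ → separable a b c * separable a′ b′ c′ ≈ separable (a ⋆ a′) (b ⋆ b′) (c ⋆ c′)
separable-* a b c a′ b′ c′ n k ℓ = begin
  (separable a b c * separable a′ b′ c′) n k ℓ
    -- The second factor becomes sliced by absorbing `c′` into its x part.
    ≡⟨ *-cong {separable a b c} (λ _ _ _ → refl) (λ i j l → sym (ℚ.*-assoc (c′ l) (a′ i) (b′ j))) n k ℓ ⟩
  (separable a b c * sliced (λ l i → c′ l ℚ.* a′ i) (λ _ → b′)) n k ℓ
    ≡⟨ separable-*-sliced a b c (λ l i → c′ l ℚ.* a′ i) (λ _ → b′) n k ℓ ⟩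
  (∑≤ ℓ λ l → c l ℚ.* ((a ⋆ λ i → c′ (ℓ ∸ l) ℚ.* a′ i) n ℚ.* (b ⋆ b′) k))
    ≡⟨ (∑-cong ℓ λ l → trans (cong (λ z → c l ℚ.* (z ℚ.* (b ⋆ b′) k)) (⋆-scaleʳ (c′ (ℓ ∸ l)) a a′ n))
         (solve 4 (λ p q r s → p :* (q :* r :* s) := p :* q :* (r :* s)) refl
           (c l) (c′ (ℓ ∸ l)) ((a ⋆ a′) n) ((b ⋆ b′) k))) ⟩
  (∑≤ ℓ λ l → c l ℚ.* c′ (ℓ ∸ l) ℚ.* ((a ⋆ a′) n ℚ.* (b ⋆ b′) k))
    ≡⟨ ∑-*ʳ ℓ _ (λ l → c l ℚ.* c′ (ℓ ∸ l)) ⟩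
  (c ⋆ c′) ℓ ℚ.* ((a ⋆ a′) n ℚ.* (b ⋆ b′) k) ∎

separable-cong : ∀ {a a′ b b′ c c′ : ℕ → ℚ} → (∀ n → a n ≡ a′ n) → (∀ n → b n ≡ b′ n) → (∀ n → c n ≡ c′ n) →
                 separable a b c ≈ separable a′ b′ c′
separable-cong p q r n k ℓ = cong₂ ℚ._*_ (r ℓ) (cong₂ ℚ._*_ (p n) (q k))

-- Monomials and the three exponentials.

monomial : ℕ → ℕ → ℕ → Series
monomial i j l = separable (dirac i) (dirac j) (dirac l)

monomial-* : ∀ {i j l n k ℓ} A → i ≤ n → j ≤ k → l ≤ ℓ → (monomial i j l * A) n k ℓ ≡ A (n ∸ i) (k ∸ j) (ℓ ∸ l)
monomial-* {i} {j} {l} {n} {k} {ℓ} A i≤n j≤k l≤ℓ = begin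
  (monomial i j l * A) n k ℓ
    ≡⟨ (∑-cong n λ a → trans
          (∑-cong k λ b → trans
            (∑-cong ℓ λ c → solve 4 (λ p q r t → r :* (p :* q) :* t := r :* (p :* (q :* t))) refl
              (dirac i a) (dirac j b) (dirac l c) (A (n ∸ a) (k ∸ b) (ℓ ∸ c)))
            (∑-dirac l≤ℓ λ c → dirac i a ℚ.* (dirac j b ℚ.* A (n ∸ a) (k ∸ b) (ℓ ∸ c))))
          (∑-*ˡ k (dirac i a) λ b → dirac j b ℚ.* A (n ∸ a) (k ∸ b) (ℓ ∸ l))) ⟩
  (∑≤ n λ a → dirac i a ℚ.* ∑≤ k λ b → dirac j b ℚ.* A (n ∸ a) (k ∸ b) (ℓ ∸ l))
    ≡⟨ ∑-dirac i≤n (λ a → ∑≤ k λ b → dirac j b ℚ.* A (n ∸ a) (k ∸ b) (ℓ ∸ l)) ⟩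
  (∑≤ k λ b → dirac j b ℚ.* A (n ∸ i) (k ∸ b) (ℓ ∸ l))
    ≡⟨ ∑-dirac j≤k (λ b → A (n ∸ i) (k ∸ b) (ℓ ∸ l)) ⟩
  A (n ∸ i) (k ∸ j) (ℓ ∸ l) ∎

one≈ : one ≈ monomial 0 0 0
one≈ zero    zero    zero    = refl
one≈ zero    zero    (suc ℓ) = refl
one≈ zero    (suc k) ℓ       = sym (ℚ.*-zeroʳ (dirac 0 ℓ))
one≈ (suc n) k       ℓ       = sym (trans (cong (dirac 0 ℓ ℚ.*_) (ℚ.*-zeroˡ (dirac 0 k))) (ℚ.*-zeroʳ (dirac 0 ℓ)))

x≈ : x ≈ monomial 1 0 0
x≈ 0             k       ℓ       = sym (trans (cong (dirac 0 ℓ ℚ.*_) (ℚ.*-zeroˡ (dirac 0 k))) (ℚ.*-zeroʳ (dirac 0 ℓ)))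
x≈ 1             zero    zero    = refl
x≈ 1             zero    (suc ℓ) = refl
x≈ 1             (suc k) ℓ       = sym (ℚ.*-zeroʳ (dirac 0 ℓ))
x≈ (suc (suc n)) k       ℓ       = sym (trans (cong (dirac 0 ℓ ℚ.*_) (ℚ.*-zeroˡ (dirac 0 k))) (ℚ.*-zeroʳ (dirac 0 ℓ)))

y≈ : y ≈ monomial 0 1 0
y≈ (suc n) k             ℓ       = sym (trans (cong (dirac 0 ℓ ℚ.*_) (ℚ.*-zeroˡ (dirac 1 k))) (ℚ.*-zeroʳ (dirac 0 ℓ)))
y≈ zero    0             ℓ       = sym (ℚ.*-zeroʳ (dirac 0 ℓ))
y≈ zero    1             zero    = refl
y≈ zero    1             (suc ℓ) = refl
y≈ zero    (suc (suc k)) ℓ       = sym (ℚ.*-zeroʳ (dirac 0 ℓ))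

u≈ : u ≈ monomial 0 0 1
u≈ zero    zero    0             = refl
u≈ zero    zero    1             = refl
u≈ zero    zero    (suc (suc ℓ)) = refl
u≈ zero    (suc k) ℓ             = sym (ℚ.*-zeroʳ (dirac 1 ℓ))
u≈ (suc n) k       ℓ             = sym (trans (cong (dirac 1 ℓ ℚ.*_) (ℚ.*-zeroˡ (dirac 0 k))) (ℚ.*-zeroʳ (dirac 1 ℓ)))

x*-zero : ∀ A k ℓ → (x * A) 0 k ℓ ≡ 0ℚ
x*-zero A k ℓ = ∑-vanish k λ b → ∑-vanish ℓ λ c → ℚ.*-zeroˡ (A 0 (k ∸ b) (ℓ ∸ c))

x*-suc : ∀ A n k ℓ → (x * A) (suc n) k ℓ ≡ A n k ℓ
x*-suc A n k ℓ = trans (*-cong {B = A} x≈ (λ _ _ _ → refl) (suc n) k ℓ) (monomial-* A (s≤s z≤n) z≤n z≤n)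

y*-zero : ∀ A n ℓ → (y * A) n 0 ℓ ≡ 0ℚ
y*-zero A n ℓ = ∑-vanish n λ a → ∑-vanish ℓ λ c →
  trans (cong (ℚ._* A (n ∸ a) 0 (ℓ ∸ c)) (y-zero a c)) (ℚ.*-zeroˡ (A (n ∸ a) 0 (ℓ ∸ c)))
  where
  y-zero : ∀ a c → y a 0 c ≡ 0ℚ
  y-zero zero    c = refl
  y-zero (suc a) c = refl

y*-suc : ∀ A n k ℓ → (y * A) n (suc k) ℓ ≡ A n k ℓ
y*-suc A n k ℓ = trans (*-cong {B = A} y≈ (λ _ _ _ → refl) n (suc k) ℓ) (monomial-* A z≤n (s≤s z≤n) z≤n)

x^≈ : ∀ m → x ^ m ≈ monomial m 0 0
x^≈ zero    = one≈
x^≈ (suc m) zero    k ℓ = trans (x*-zero (x ^ m) k ℓ)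
  (sym (trans (cong (dirac 0 ℓ ℚ.*_) (ℚ.*-zeroˡ (dirac 0 k))) (ℚ.*-zeroʳ (dirac 0 ℓ))))
x^≈ (suc m) (suc n) k ℓ = trans (x*-suc (x ^ m) n k ℓ) (x^≈ m n k ℓ)

y^≈ : ∀ m → y ^ m ≈ monomial 0 m 0
y^≈ zero    = one≈
y^≈ (suc m) n zero    ℓ = trans (y*-zero (y ^ m) n ℓ)
  (sym (trans (cong (dirac 0 ℓ ℚ.*_) (ℚ.*-zeroʳ (dirac 0 n))) (ℚ.*-zeroʳ (dirac 0 ℓ))))
y^≈ (suc m) n (suc k) ℓ = trans (y*-suc (y ^ m) n k ℓ) (y^≈ m n k ℓ)

-- Only the summand m = n contributes, and it lies below the truncation n + k + ℓ.
exp-x≈ : exp x ≈ separable e (dirac 0) (dirac 0)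
exp-x≈ n k ℓ = begin
  (∑≤ (n ℕ.+ k ℕ.+ ℓ) λ m → (x ^ m) n k ℓ ℚ.* e m)
    ≡⟨ (∑-cong (n ℕ.+ k ℕ.+ ℓ) λ m → trans
          (cong (ℚ._* e m) (trans (x^≈ m n k ℓ) (cong (λ d → dirac 0 ℓ ℚ.* (d ℚ.* dirac 0 k)) (dirac-sym m n))))
          (solve 4 (λ l d c f → l :* (d :* c) :* f := d :* (l :* (f :* c))) refl
            (dirac 0 ℓ) (dirac n m) (dirac 0 k) (e m))) ⟩
  (∑≤ (n ℕ.+ k ℕ.+ ℓ) λ m → dirac n m ℚ.* (dirac 0 ℓ ℚ.* (e m ℚ.* dirac 0 k)))
    ≡⟨ ∑-dirac (ℕ.≤-trans (ℕ.m≤m+n n k) (ℕ.m≤m+n _ ℓ)) (λ m → dirac 0 ℓ ℚ.* (e m ℚ.* dirac 0 k)) ⟩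
  dirac 0 ℓ ℚ.* (e n ℚ.* dirac 0 k) ∎

exp-y≈ : exp y ≈ separable (dirac 0) e (dirac 0)
exp-y≈ n k ℓ = begin
  (∑≤ (n ℕ.+ k ℕ.+ ℓ) λ m → (y ^ m) n k ℓ ℚ.* e m)
    ≡⟨ (∑-cong (n ℕ.+ k ℕ.+ ℓ) λ m → trans
          (cong (ℚ._* e m) (trans (y^≈ m n k ℓ) (cong (λ d → dirac 0 ℓ ℚ.* (dirac 0 n ℚ.* d)) (dirac-sym m k))))
          (solve 4 (λ l d c f → l :* (c :* d) :* f := d :* (l :* (c :* f))) refl
            (dirac 0 ℓ) (dirac k m) (dirac 0 n) (e m))) ⟩
  (∑≤ (n ℕ.+ k ℕ.+ ℓ) λ m → dirac k m ℚ.* (dirac 0 ℓ ℚ.* (dirac 0 n ℚ.* e m)))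
    ≡⟨ ∑-dirac (ℕ.≤-trans (ℕ.m≤n+m k n) (ℕ.m≤m+n _ ℓ)) (λ m → dirac 0 ℓ ℚ.* (dirac 0 n ℚ.* e m)) ⟩
  dirac 0 ℓ ℚ.* (dirac 0 n ℚ.* e k) ∎

-- The binomial theorem, with the coefficient for m = n + k written as m! / (n! k!).
[x+y]^≈ : ∀ m n k ℓ → ((x + y) ^ m) n k ℓ ≡ dirac m (n ℕ.+ k) ℚ.* (⟦ m ! ⟧ ℚ.* (dirac 0 ℓ ℚ.* (e n ℚ.* e k)))
[x+y]^≈ zero n k ℓ = trans (one≈ n k ℓ) (base n k)
  where
  base : ∀ n k → monomial 0 0 0 n k ℓ ≡ dirac 0 (n ℕ.+ k) ℚ.* (1ℚ ℚ.* (dirac 0 ℓ ℚ.* (e n ℚ.* e k)))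
  base zero    zero    = solve 1 (λ d → d :* con 1ℚ := con 1ℚ :* (con 1ℚ :* (d :* con 1ℚ))) refl (dirac 0 ℓ)
  base zero    (suc k) = trans (ℚ.*-zeroʳ (dirac 0 ℓ)) (sym (ℚ.*-zeroˡ (1ℚ ℚ.* (dirac 0 ℓ ℚ.* (e 0 ℚ.* e (suc k))))))
  base (suc n) k       = trans (trans (cong (dirac 0 ℓ ℚ.*_) (ℚ.*-zeroˡ (dirac 0 k))) (ℚ.*-zeroʳ (dirac 0 ℓ)))
    (sym (ℚ.*-zeroˡ (1ℚ ℚ.* (dirac 0 ℓ ℚ.* (e (suc n) ℚ.* e k)))))
[x+y]^≈ (suc m) n k ℓ = trans (*-distribʳ-+ x y ((x + y) ^ m) n k ℓ) (step n k)
  where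
  Z : Series
  Z = (x + y) ^ m
  M = ⟦ m ! ⟧
  d = dirac 0 ℓ

  -- Under the delta p equals m, so the factor p + 1 extracted from `v` turns m! into (m + 1)!.
  absorb : ∀ p {v w} → v ≡ ⟦ suc p ⟧ ℚ.* w →
           dirac m p ℚ.* (M ℚ.* (d ℚ.* v)) ≡ dirac m p ℚ.* (⟦ suc m ! ⟧ ℚ.* (d ℚ.* w))
  absorb p {v} {w} v≡ = begin
    dirac m p ℚ.* (M ℚ.* (d ℚ.* v))
      ≡⟨ cong (λ v → dirac m p ℚ.* (M ℚ.* (d ℚ.* v))) v≡ ⟩
    dirac m p ℚ.* (M ℚ.* (d ℚ.* (⟦ suc p ⟧ ℚ.* w)))
      ≡⟨ move (dirac m p) M d ⟦ suc p ⟧ w ⟩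
    dirac m p ℚ.* ⟦ suc p ⟧ ℚ.* (M ℚ.* (d ℚ.* w))
      ≡⟨ cong (ℚ._* (M ℚ.* (d ℚ.* w))) (sym (dirac-subst m p (λ i → ⟦ suc i ⟧))) ⟩
    dirac m p ℚ.* ⟦ suc m ⟧ ℚ.* (M ℚ.* (d ℚ.* w))
      ≡⟨ solve 5 (λ a b c f g → a :* b :* (c :* (f :* g)) := a :* (b :* c :* (f :* g))) refl
           (dirac m p) ⟦ suc m ⟧ M d w ⟩
    dirac m p ℚ.* (⟦ suc m ⟧ ℚ.* M ℚ.* (d ℚ.* w))
      ≡⟨ cong (λ f → dirac m p ℚ.* (f ℚ.* (d ℚ.* w))) (sym (⟦⟧-* (suc m) (m !))) ⟩
    dirac m p ℚ.* (⟦ suc m ! ⟧ ℚ.* (d ℚ.* w)) ∎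
    where
    move : ∀ a b c f g → a ℚ.* (b ℚ.* (c ℚ.* (f ℚ.* g))) ≡ a ℚ.* f ℚ.* (b ℚ.* (c ℚ.* g))
    move = solve 5 (λ a b c f g → a :* (b :* (c :* (f :* g))) := a :* f :* (b :* (c :* g))) refl

  step : ∀ n k → (x * Z) n k ℓ ℚ.+ (y * Z) n k ℓ
       ≡ dirac (suc m) (n ℕ.+ k) ℚ.* (⟦ suc m ! ⟧ ℚ.* (d ℚ.* (e n ℚ.* e k)))
  step zero zero = trans (cong₂ ℚ._+_ (x*-zero Z 0 ℓ) (y*-zero Z 0 ℓ))
    (sym (ℚ.*-zeroˡ (⟦ suc m ! ⟧ ℚ.* (d ℚ.* (e 0 ℚ.* e 0)))))
  step (suc n) zero = trans
    (cong₂ ℚ._+_ (trans (x*-suc Z n 0 ℓ) ([x+y]^≈ m n 0 ℓ)) (y*-zero Z (suc n) ℓ))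
    (trans (ℚ.+-identityʳ _) (absorb (n ℕ.+ 0) (begin
      e n ℚ.* e 0                              ≡⟨ cong (ℚ._* e 0) (sym (1/!-suc n)) ⟩
      ⟦ suc n ⟧ ℚ.* e (suc n) ℚ.* e 0          ≡⟨ ℚ.*-assoc ⟦ suc n ⟧ (e (suc n)) (e 0) ⟩
      ⟦ suc n ⟧ ℚ.* (e (suc n) ℚ.* e 0)        ≡⟨ cong (λ i → ⟦ suc i ⟧ ℚ.* (e (suc n) ℚ.* e 0)) (sym (ℕ.+-identityʳ n)) ⟩
      ⟦ suc (n ℕ.+ 0) ⟧ ℚ.* (e (suc n) ℚ.* e 0) ∎)))
  step zero (suc k) = trans
    (cong₂ ℚ._+_ (x*-zero Z (suc k) ℓ) (trans (y*-suc Z 0 k ℓ) ([x+y]^≈ m 0 k ℓ)))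
    (trans (ℚ.+-identityˡ _) (absorb k (begin
      e 0 ℚ.* e k                              ≡⟨ cong (e 0 ℚ.*_) (sym (1/!-suc k)) ⟩
      e 0 ℚ.* (⟦ suc k ⟧ ℚ.* e (suc k))        ≡⟨ swap (e 0) ⟦ suc k ⟧ (e (suc k)) ⟩
      ⟦ suc k ⟧ ℚ.* (e 0 ℚ.* e (suc k))        ∎)))
    where
    swap : ∀ a b c → a ℚ.* (b ℚ.* c) ≡ b ℚ.* (a ℚ.* c)
    swap = solve 3 (λ a b c → a :* (b :* c) := b :* (a :* c)) refl
  step (suc n) (suc k) = begin
    (x * Z) (suc n) (suc k) ℓ ℚ.+ (y * Z) (suc n) (suc k) ℓ
      ≡⟨ cong₂ ℚ._+_ (trans (x*-suc Z n (suc k) ℓ) ([x+y]^≈ m n (suc k) ℓ))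
                     (trans (y*-suc Z (suc n) k ℓ) ([x+y]^≈ m (suc n) k ℓ)) ⟩
    D ℚ.* (M ℚ.* (d ℚ.* (e n ℚ.* e (suc k)))) ℚ.+ dirac m (suc n ℕ.+ k) ℚ.* (M ℚ.* (d ℚ.* (e (suc n) ℚ.* e k)))
      ≡⟨ cong (λ p → D ℚ.* (M ℚ.* (d ℚ.* (e n ℚ.* e (suc k)))) ℚ.+ dirac m p ℚ.* (M ℚ.* (d ℚ.* (e (suc n) ℚ.* e k))))
           (sym (ℕ.+-suc n k)) ⟩
    D ℚ.* (M ℚ.* (d ℚ.* (e n ℚ.* e (suc k)))) ℚ.+ D ℚ.* (M ℚ.* (d ℚ.* (e (suc n) ℚ.* e k)))
      ≡⟨ solve 5 (λ a b c f g → a :* (b :* (c :* f)) :+ a :* (b :* (c :* g)) := a :* (b :* (c :* (f :+ g)))) refl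
           D M d (e n ℚ.* e (suc k)) (e (suc n) ℚ.* e k) ⟩
    D ℚ.* (M ℚ.* (d ℚ.* (e n ℚ.* e (suc k) ℚ.+ e (suc n) ℚ.* e k)))
      ≡⟨ absorb (n ℕ.+ suc k) pascal ⟩
    D ℚ.* (⟦ suc m ! ⟧ ℚ.* (d ℚ.* (e (suc n) ℚ.* e (suc k)))) ∎
    where
    D = dirac m (n ℕ.+ suc k)

    -- Pascal's rule for n + k + 2 over n + 1, divided by (n + k + 1)!.
    pascal : e n ℚ.* e (suc k) ℚ.+ e (suc n) ℚ.* e k ≡ ⟦ suc n ℕ.+ suc k ⟧ ℚ.* (e (suc n) ℚ.* e (suc k))
    pascal = begin
      e n ℚ.* e (suc k) ℚ.+ e (suc n) ℚ.* e k
        ≡⟨ cong₂ (λ a b → a ℚ.* e (suc k) ℚ.+ e (suc n) ℚ.* b) (sym (1/!-suc n)) (sym (1/!-suc k)) ⟩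
      ⟦ suc n ⟧ ℚ.* e (suc n) ℚ.* e (suc k) ℚ.+ e (suc n) ℚ.* (⟦ suc k ⟧ ℚ.* e (suc k))
        ≡⟨ solve 4 (λ a b p q → a :* p :* q :+ p :* (b :* q) := (a :+ b) :* (p :* q)) refl
             ⟦ suc n ⟧ ⟦ suc k ⟧ (e (suc n)) (e (suc k)) ⟩
      (⟦ suc n ⟧ ℚ.+ ⟦ suc k ⟧) ℚ.* (e (suc n) ℚ.* e (suc k))
        ≡⟨ cong (ℚ._* (e (suc n) ℚ.* e (suc k))) (sym (⟦⟧-+ (suc n) (suc k))) ⟩
      ⟦ suc n ℕ.+ suc k ⟧ ℚ.* (e (suc n) ℚ.* e (suc k)) ∎

exp-x+y≈ : exp (x + y) ≈ separable e e (dirac 0)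
exp-x+y≈ n k ℓ = begin
  (∑≤ N λ m → ((x + y) ^ m) n k ℓ ℚ.* e m)
    ≡⟨ (∑-cong N λ m → trans
          (cong (ℚ._* e m) (trans ([x+y]^≈ m n k ℓ) (cong (ℚ._* (⟦ m ! ⟧ ℚ.* c)) (dirac-sym m (n ℕ.+ k)))))
          (trans (ℚ.*-assoc (dirac (n ℕ.+ k) m) (⟦ m ! ⟧ ℚ.* c) (e m)) (cong (dirac (n ℕ.+ k) m ℚ.*_) (cancel m)))) ⟩
  (∑≤ N λ m → dirac (n ℕ.+ k) m ℚ.* c)
    ≡⟨ ∑-dirac (ℕ.m≤m+n (n ℕ.+ k) ℓ) (λ _ → c) ⟩
  c ∎
  where
  N = n ℕ.+ k ℕ.+ ℓ
  c = dirac 0 ℓ ℚ.* (e n ℚ.* e k)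

  cancel : ∀ m → ⟦ m ! ⟧ ℚ.* c ℚ.* e m ≡ c
  cancel m = begin
    ⟦ m ! ⟧ ℚ.* c ℚ.* e m     ≡⟨ solve 3 (λ a b f → a :* b :* f := a :* f :* b) refl ⟦ m ! ⟧ c (e m) ⟩
    ⟦ m ! ⟧ ℚ.* e m ℚ.* c     ≡⟨ cong (ℚ._* c) (⟦⟧-inverse (m !) ⦃ m ℕ.!≢0 ⦄) ⟩
    1ℚ ℚ.* c                  ≡⟨ ℚ.*-identityˡ c ⟩
    c                         ∎

-- Numerator, denominator and the inverse of the denominator.

dirac-< : ∀ {m i} → i ℕ.< m → dirac m i ≡ 0ℚ
dirac-< {suc m} {zero}  _         = refl
dirac-< {suc m} {suc i} (s≤s i<m) = dirac-< i<m

∑-dirac-< : ∀ {m n} → n ℕ.< m → (f : ℕ → ℚ) → ∑≤ n (λ i → dirac m i ℚ.* f i) ≡ 0ℚ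
∑-dirac-< {m} {n} n<m f = trans
  (∑-cong≤ n λ i i≤n → trans (cong (ℚ._* f i) (dirac-< (ℕ.≤-<-trans i≤n n<m))) (ℚ.*-zeroˡ (f i))) (∑-0 n)

-- The factor u^j shifts the slices by j.
layer-*-sliced : ∀ a b P Q {j n k ℓ} → j ≤ ℓ →
                 (separable a b (dirac j) * sliced P Q) n k ℓ ≡ (a ⋆ P (ℓ ∸ j)) n ℚ.* (b ⋆ Q (ℓ ∸ j)) k
layer-*-sliced a b P Q {j} {n} {k} {ℓ} j≤ℓ = trans (separable-*-sliced a b (dirac j) P Q n k ℓ)
  (∑-dirac j≤ℓ (λ l → (a ⋆ P (ℓ ∸ l)) n ℚ.* (b ⋆ Q (ℓ ∸ l)) k))

layer-*-sliced-< : ∀ a b P Q {j n k ℓ} → ℓ ℕ.< j → (separable a b (dirac j) * sliced P Q) n k ℓ ≡ 0ℚ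
layer-*-sliced-< a b P Q {j} {n} {k} {ℓ} ℓ<j = trans (separable-*-sliced a b (dirac j) P Q n k ℓ)
  (∑-dirac-< ℓ<j (λ l → (a ⋆ P (ℓ ∸ l)) n ℚ.* (b ⋆ Q (ℓ ∸ l)) k))

exp-x-1≈ : exp x - one ≈ separable e-1 (dirac 0) (dirac 0)
exp-x-1≈ n k ℓ = trans (minus-cong exp-x≈ one≈ n k ℓ)
  (solve 4 (λ a b c d → a :* (b :* c) :- a :* (d :* c) := a :* ((b :- d) :* c)) refl
    (dirac 0 ℓ) (e n) (dirac 0 k) (dirac 0 n))

exp-y-1≈ : exp y - one ≈ separable (dirac 0) e-1 (dirac 0)
exp-y-1≈ n k ℓ = trans (minus-cong exp-y≈ one≈ n k ℓ)
  (solve 4 (λ a b c d → a :* (c :* b) :- a :* (c :* d) := a :* (c :* (b :- d))) refl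
    (dirac 0 ℓ) (e k) (dirac 0 n) (dirac 0 k))

u-1 : ℕ → ℚ
u-1 ℓ = dirac 1 ℓ ℚ.- dirac 0 ℓ

u-one≈ : u - one ≈ separable (dirac 0) (dirac 0) u-1
u-one≈ n k ℓ = trans (minus-cong u≈ one≈ n k ℓ)
  (solve 3 (λ a b c → a :* c :- b :* c := (a :- b) :* c) refl (dirac 1 ℓ) (dirac 0 ℓ) (dirac 0 n ℚ.* dirac 0 k))

-- Covers both u² and (u - 1)², as each base is a series in u alone with coefficients `c`.
square-term≈ : ∀ {A} c → A ≈ separable (dirac 0) (dirac 0) c →
               A ^ 2 * (exp x - one) * (exp y - one) ≈ separable e-1 e-1 (c ⋆ c)
square-term≈ {A} c A≈ = ≈-trans (*-cong with-x exp-y-1≈)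
  (≈-trans (separable-* e-1 δ (c ⋆ c) δ e-1 δ)
    (separable-cong {c = c ⋆ c ⋆ δ} (⋆-identityʳ e-1) (⋆-identityˡ e-1) (⋆-identityʳ (c ⋆ c))))
  where
  δ = dirac 0

  A*one : A * one ≈ separable δ δ c
  A*one = ≈-trans (*-cong A≈ one≈) (≈-trans (separable-* δ δ c δ δ δ)
    (separable-cong {c = c ⋆ δ} (⋆-identityˡ δ) (⋆-identityˡ δ) (⋆-identityʳ c)))

  square : A ^ 2 ≈ separable δ δ (c ⋆ c)
  square = ≈-trans (*-cong A≈ A*one) (≈-trans (separable-* δ δ c δ δ c)
    (separable-cong {c = c ⋆ c} (⋆-identityˡ δ) (⋆-identityˡ δ) (λ _ → refl)))

  with-x : A ^ 2 * (exp x - one) ≈ separable e-1 δ (c ⋆ c)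
  with-x = ≈-trans (*-cong square exp-x-1≈) (≈-trans (separable-* δ δ (c ⋆ c) e-1 δ δ)
    (separable-cong {c = c ⋆ c ⋆ δ} (⋆-identityˡ e-1) (⋆-identityˡ δ) (⋆-identityʳ (c ⋆ c))))

dirac1-⋆-suc : ∀ a n → (dirac 1 ⋆ a) (suc n) ≡ a n
dirac1-⋆-suc a n = ∑-dirac {1} {suc n} (s≤s z≤n) (λ i → a (suc n ∸ i))

u² : ∀ ℓ → (dirac 1 ⋆ dirac 1) ℓ ≡ dirac 2 ℓ
u² zero    = refl
u² (suc ℓ) = dirac1-⋆-suc (dirac 1) ℓ

[u-1]² : ∀ ℓ → (u-1 ⋆ u-1) ℓ ≡ dirac 0 ℓ ℚ.- dirac 1 ℓ ℚ.- dirac 1 ℓ ℚ.+ dirac 2 ℓ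
[u-1]² zero    = refl
[u-1]² (suc ℓ) = begin
  (u-1 ⋆ u-1) (suc ℓ)
    -- Adding and subtracting 1 · (u - 1) turns the left factor into u, which merely shifts: (u -
    -- 1)² = u (u - 1) - (u - 1).
    ≡⟨ solve 2 (λ p q → p := (q :+ p) :- q) refl ((u-1 ⋆ u-1) (suc ℓ)) ((dirac 0 ⋆ u-1) (suc ℓ)) ⟩
  (dirac 0 ⋆ u-1) (suc ℓ) ℚ.+ (u-1 ⋆ u-1) (suc ℓ) ℚ.- (dirac 0 ⋆ u-1) (suc ℓ)
    ≡⟨ cong₂ ℚ._-_ (sym (⋆-distribʳ (dirac 0) u-1 u-1 (suc ℓ))) (⋆-identityˡ u-1 (suc ℓ)) ⟩
  ((λ i → dirac 0 i ℚ.+ u-1 i) ⋆ u-1) (suc ℓ) ℚ.- u-1 (suc ℓ)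
    ≡⟨ cong (ℚ._- u-1 (suc ℓ)) (trans (⋆-cong {b = u-1}
         (λ i → solve 2 (λ p q → q :+ (p :- q) := p) refl (dirac 1 i) (dirac 0 i)) (λ _ → refl) (suc ℓ))
         (dirac1-⋆-suc u-1 ℓ)) ⟩
  u-1 ℓ ℚ.- u-1 (suc ℓ)
    ≡⟨ solve 2 (λ p q → (p :- q) :- (q :- con 0ℚ) := con 0ℚ :- q :- q :+ p) refl (dirac 1 ℓ) (dirac 0 ℓ) ⟩
  0ℚ ℚ.- dirac 0 ℓ ℚ.- dirac 0 ℓ ℚ.+ dirac 1 ℓ ∎

numerator denominator residue : Series
numerator   = exp (x + y) - (u - one) ^ 2 * (exp x - one) * (exp y - one)
denominator = one - u ^ 2 * (exp x - one) * (exp y - one)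
residue     = separable e-1 (dirac 0) (dirac 0) + separable (dirac 0) e-1 (dirac 0)
            + (separable e-1 e-1 (dirac 1) + separable e-1 e-1 (dirac 1))

denominator≈ : denominator ≈ monomial 0 0 0 - separable e-1 e-1 (dirac 2)
denominator≈ = minus-cong one≈ (≈-trans (square-term≈ {u} (dirac 1) u≈) (separable-cong {e-1} {b = e-1} (λ _ → refl) (λ _ → refl) u²))

-- From e^(x+y) = (1 + X)(1 + Y) and (u - 1)² = 1 - 2u + u²: the plain XY terms cancel, -u²XY goes
-- to the denominator, and X + Y + 2uXY remains.
numerator≈ : numerator ≈ denominator + residue
numerator≈ n k ℓ = begin
  numerator n k ℓ
    ≡⟨ minus-cong exp-x+y≈ (square-term≈ {u - one} u-1 u-one≈) n k ℓ ⟩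
  d₀ ℚ.* (e n ℚ.* e k) ℚ.- (u-1 ⋆ u-1) ℓ ℚ.* (e-1 n ℚ.* e-1 k)
    ≡⟨ cong₂ (λ p q → d₀ ℚ.* p ℚ.- q ℚ.* (e-1 n ℚ.* e-1 k)) (cong₂ ℚ._*_ (e≡1+e-1 n) (e≡1+e-1 k)) ([u-1]² ℓ) ⟩
  d₀ ℚ.* ((i ℚ.+ e-1 n) ℚ.* (j ℚ.+ e-1 k)) ℚ.- (d₀ ℚ.- d₁ ℚ.- d₁ ℚ.+ d₂) ℚ.* (e-1 n ℚ.* e-1 k)
    ≡⟨ solve 7 (λ a b c i p j q →
         a :* ((i :+ p) :* (j :+ q)) :- (a :- b :- b :+ c) :* (p :* q)
         := (a :* (i :* j) :- c :* (p :* q))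
            :+ (a :* (p :* j) :+ a :* (i :* q) :+ (b :* (p :* q) :+ b :* (p :* q))))
         refl d₀ d₁ d₂ i (e-1 n) j (e-1 k) ⟩
  (monomial 0 0 0 - separable e-1 e-1 (dirac 2) + residue) n k ℓ
    ≡⟨ cong (ℚ._+ residue n k ℓ) (sym (denominator≈ n k ℓ)) ⟩
  (denominator + residue) n k ℓ ∎
  where
  d₀ = dirac 0 ℓ
  d₁ = dirac 1 ℓ
  d₂ = dirac 2 ℓ
  i = dirac 0 n
  j = dirac 0 k

-- The coefficient of u^ℓ in 1 / (1 − u² (e^x − 1) (e^y − 1)) is slice ℓ in x times slice ℓ in y.
slice : ℕ → ℕ → ℚ
slice 0             = dirac 0
slice 1             = λ _ → 0ℚ
slice (suc (suc ℓ)) = e-1 ⋆ slice ℓ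

inverse : Series
inverse = sliced slice slice

-- Multiplying by u²XY moves slice ℓ to slice ℓ + 2, so the difference cancels from u² on. Slice 1
-- is 0, and slice 0 leaves the constant 1.
denominator-inverse : denominator * inverse ≈ one
denominator-inverse n k ℓ = begin
  (denominator * inverse) n k ℓ
    ≡⟨ *-cong {B = inverse} denominator≈ (λ _ _ _ → refl) n k ℓ ⟩
  ((monomial 0 0 0 - separable e-1 e-1 (dirac 2)) * inverse) n k ℓ
    ≡⟨ *-distribʳ-minus (monomial 0 0 0) (separable e-1 e-1 (dirac 2)) inverse n k ℓ ⟩
  (monomial 0 0 0 * inverse) n k ℓ ℚ.- (separable e-1 e-1 (dirac 2) * inverse) n k ℓ
    ≡⟨ cong (ℚ._- (separable e-1 e-1 (dirac 2) * inverse) n k ℓ) (monomial-* {0} {0} {0} {n} {k} {ℓ} inverse z≤n z≤n z≤n) ⟩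
  inverse n k ℓ ℚ.- (separable e-1 e-1 (dirac 2) * inverse) n k ℓ
    ≡⟨ telescope ℓ ⟩
  monomial 0 0 0 n k ℓ
    ≡⟨ sym (one≈ n k ℓ) ⟩
  one n k ℓ ∎
  where
  telescope : ∀ ℓ → inverse n k ℓ ℚ.- (separable e-1 e-1 (dirac 2) * inverse) n k ℓ ≡ monomial 0 0 0 n k ℓ
  telescope 0 = trans (cong (λ z → inverse n k 0 ℚ.- z) (layer-*-sliced-< e-1 e-1 slice slice {2} {n} {k} {0} (s≤s z≤n)))
    (solve 1 (λ p → p :- con 0ℚ := con 1ℚ :* p) refl (dirac 0 n ℚ.* dirac 0 k))
  telescope 1 = trans (cong (λ z → inverse n k 1 ℚ.- z) (layer-*-sliced-< e-1 e-1 slice slice {2} {n} {k} {1} (s≤s (s≤s z≤n))))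
    (sym (ℚ.*-zeroˡ (dirac 0 n ℚ.* dirac 0 k)))
  telescope (suc (suc ℓ)) = trans
    (cong (λ z → inverse n k (2 ℕ.+ ℓ) ℚ.- z) (layer-*-sliced e-1 e-1 slice slice {2} {n} {k} {2 ℕ.+ ℓ} (s≤s (s≤s z≤n))))
    (trans (ℚ.+-inverseʳ (inverse n k (2 ℕ.+ ℓ))) (sym (ℚ.*-zeroˡ (dirac 0 n ℚ.* dirac 0 k))))

-- Comparing coefficients by the parity of the path length.

double : ℕ → ℕ
double zero    = zero
double (suc m) = suc (suc (double m))

data Parity : ℕ → Set where
  even : ∀ m → Parity (double m)
  odd  : ∀ m → Parity (suc (double m))

parity : ∀ ℓ → Parity ℓ
parity zero = even 0
parity (suc ℓ) with parity ℓ
... | even m = odd m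
... | odd m  = even (suc m)

slice-even : ∀ m n → slice (double m) n ≡ power m n
slice-even zero    n = refl
slice-even (suc m) n = ⋆-cong {a = e-1} (λ _ → refl) (slice-even m) n

slice-odd : ∀ m n → slice (suc (double m)) n ≡ 0ℚ
slice-odd zero    n = refl
slice-odd (suc m) n = trans (⋆-cong {a = e-1} (λ _ → refl) (slice-odd m) n) (⋆-zeroʳ e-1 n)

blocks-even : ∀ m → blocks true (double m) ≡ suc m
blocks-even zero    = refl
blocks-even (suc m) = cong suc (blocks-even m)

blocks-even′ : ∀ m → blocks false (double m) ≡ m
blocks-even′ zero    = refl
blocks-even′ (suc m) = cong suc (blocks-even′ m)

alternatingPowers : ℕ → ℕ → ℕ → ℚ
alternatingPowers n k ℓ = power (blocks true ℓ) n ℚ.* power (blocks false ℓ) k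
                        ℚ.+ power (blocks false ℓ) n ℚ.* power (blocks true ℓ) k

-- The inverse has only even powers of u. At ℓ = 2m the terms X and Y give X^(m+1) Y^m + X^m
-- Y^(m+1). At ℓ = 2m + 1 only 2uXY contributes, and its 2 accounts for the two block patterns,
-- which both have m + 1 blocks on each side.
residue-inverse : ∀ n k ℓ → (residue * inverse) n k ℓ ≡ alternatingPowers n k ℓ
residue-inverse n k ℓ = begin
  (residue * inverse) n k ℓ
    ≡⟨ *-distribʳ-+ (separable e-1 (dirac 0) (dirac 0) + separable (dirac 0) e-1 (dirac 0))
         (S₁ + S₁) inverse n k ℓ ⟩
  ((separable e-1 (dirac 0) (dirac 0) + separable (dirac 0) e-1 (dirac 0)) * inverse) n k ℓ
    ℚ.+ ((S₁ + S₁) * inverse) n k ℓ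
    ≡⟨ cong₂ ℚ._+_
         (trans (*-distribʳ-+ (separable e-1 (dirac 0) (dirac 0)) (separable (dirac 0) e-1 (dirac 0)) inverse n k ℓ)
           (cong₂ ℚ._+_ outerˣ outerʸ))
         (*-distribʳ-+ S₁ S₁ inverse n k ℓ) ⟩
  (e-1 ⋆ slice ℓ) n ℚ.* slice ℓ k ℚ.+ slice ℓ n ℚ.* (e-1 ⋆ slice ℓ) k
    ℚ.+ ((S₁ * inverse) n k ℓ ℚ.+ (S₁ * inverse) n k ℓ)
    ≡⟨ compare (parity ℓ) ⟩
  alternatingPowers n k ℓ ∎
  where
  S₁ = separable e-1 e-1 (dirac 1)

  outerˣ : (separable e-1 (dirac 0) (dirac 0) * inverse) n k ℓ ≡ (e-1 ⋆ slice ℓ) n ℚ.* slice ℓ k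
  outerˣ = trans (layer-*-sliced e-1 (dirac 0) slice slice {0} {n} {k} {ℓ} z≤n)
    (cong ((e-1 ⋆ slice ℓ) n ℚ.*_) (⋆-identityˡ (slice ℓ) k))

  outerʸ : (separable (dirac 0) e-1 (dirac 0) * inverse) n k ℓ ≡ slice ℓ n ℚ.* (e-1 ⋆ slice ℓ) k
  outerʸ = trans (layer-*-sliced (dirac 0) e-1 slice slice {0} {n} {k} {ℓ} z≤n)
    (cong (ℚ._* (e-1 ⋆ slice ℓ) k) (⋆-identityˡ (slice ℓ) n))

  S₁-even : ∀ m → (S₁ * inverse) n k (double m) ≡ 0ℚ
  S₁-even zero    = layer-*-sliced-< e-1 e-1 slice slice {1} {n} {k} (s≤s z≤n)
  S₁-even (suc m) = trans (layer-*-sliced e-1 e-1 slice slice {1} {n} {k} {double (suc m)} (s≤s z≤n))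
    (trans (cong (ℚ._* (e-1 ⋆ slice (suc (double m))) k) (slice-odd (suc m) n)) (ℚ.*-zeroˡ ((e-1 ⋆ slice (suc (double m))) k)))

  S₁-odd : ∀ m → (S₁ * inverse) n k (suc (double m)) ≡ power (suc m) n ℚ.* power (suc m) k
  S₁-odd m = trans (layer-*-sliced e-1 e-1 slice slice {1} {n} {k} {suc (double m)} (s≤s z≤n))
    (cong₂ ℚ._*_ (slice-even (suc m) n) (slice-even (suc m) k))

  powers : ℕ → ℕ → ℚ
  powers p q = power p n ℚ.* power q k ℚ.+ power q n ℚ.* power p k

  assemble : ∀ {a a′ b b′ c c′ d d′ s s′} → a ≡ a′ → b ≡ b′ → c ≡ c′ → d ≡ d′ → s ≡ s′ →
             a ℚ.* b ℚ.+ c ℚ.* d ℚ.+ (s ℚ.+ s) ≡ a′ ℚ.* b′ ℚ.+ c′ ℚ.* d′ ℚ.+ (s′ ℚ.+ s′)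
  assemble refl refl refl refl refl = refl

  compare : ∀ {ℓ} → Parity ℓ →
            (e-1 ⋆ slice ℓ) n ℚ.* slice ℓ k ℚ.+ slice ℓ n ℚ.* (e-1 ⋆ slice ℓ) k
              ℚ.+ ((S₁ * inverse) n k ℓ ℚ.+ (S₁ * inverse) n k ℓ)
          ≡ alternatingPowers n k ℓ
  compare (even m) = trans
    (assemble (slice-even (suc m) n) (slice-even m k) (slice-even m n) (slice-even (suc m) k) (S₁-even m))
    (trans (ℚ.+-identityʳ _) (sym (cong₂ powers (blocks-even m) (blocks-even′ m))))
  compare (odd m) = trans
    (assemble (slice-odd (suc m) n) (slice-odd m k) (slice-odd m n) (slice-odd (suc m) k) (S₁-odd m))
    (trans (ℚ.+-identityˡ _) (sym (cong₂ powers (cong suc (blocks-even′ m)) (blocks-even m))))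

F≈ : ∀ n k ℓ → F n k ℓ ≡ one n k ℓ ℚ.+ alternatingPowers n k ℓ
F≈ n k ℓ = begin
  ⟦ G n k ℓ ⟧ ℚ.* e n ℚ.* e k
    ≡⟨ cong (λ z → z ℚ.* e n ℚ.* e k) expand ⟩
  (⟦ emptyGraph n k ℓ ⟧ ℚ.+ (⟦ a ⟧ ℚ.* ⟦ b ⟧ ℚ.+ ⟦ c ⟧ ℚ.* ⟦ d ⟧)) ℚ.* e n ℚ.* e k
    ≡⟨ solve 7 (λ o a b c d p q → (o :+ (a :* b :+ c :* d)) :* p :* q
         := o :* p :* q :+ ((a :* p) :* (b :* q) :+ (c :* p) :* (d :* q))) refl
         ⟦ emptyGraph n k ℓ ⟧ ⟦ a ⟧ ⟦ b ⟧ ⟦ c ⟧ ⟦ d ⟧ (e n) (e k) ⟩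
  ⟦ emptyGraph n k ℓ ⟧ ℚ.* e n ℚ.* e k
    ℚ.+ ((⟦ a ⟧ ℚ.* e n) ℚ.* (⟦ b ⟧ ℚ.* e k) ℚ.+ (⟦ c ⟧ ℚ.* e n) ℚ.* (⟦ d ⟧ ℚ.* e k))
    ≡⟨ cong₂ ℚ._+_ (constant n k ℓ) (sym (cong₂ ℚ._+_
         (cong₂ ℚ._*_ (power-surjections n (blocks true ℓ)) (power-surjections k (blocks false ℓ)))
         (cong₂ ℚ._*_ (power-surjections n (blocks false ℓ)) (power-surjections k (blocks true ℓ))))) ⟩
  one n k ℓ ℚ.+ alternatingPowers n k ℓ ∎
  where
  a = surjections n (blocks true ℓ)
  b = surjections k (blocks false ℓ)
  c = surjections n (blocks false ℓ)
  d = surjections k (blocks true ℓ)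

  expand : ⟦ G n k ℓ ⟧ ≡ ⟦ emptyGraph n k ℓ ⟧ ℚ.+ (⟦ a ⟧ ℚ.* ⟦ b ⟧ ℚ.+ ⟦ c ⟧ ℚ.* ⟦ d ⟧)
  expand = trans (cong ⟦_⟧ (G-formula n k ℓ)) (trans (⟦⟧-+ (emptyGraph n k ℓ) _)
    (cong (⟦ emptyGraph n k ℓ ⟧ ℚ.+_) (trans (⟦⟧-+ (a ℕ.* b) (c ℕ.* d)) (cong₂ ℚ._+_ (⟦⟧-* a b) (⟦⟧-* c d)))))

  constant : ∀ n k ℓ → ⟦ emptyGraph n k ℓ ⟧ ℚ.* e n ℚ.* e k ≡ one n k ℓ
  constant zero    zero    zero    = refl
  constant zero    zero    (suc ℓ) = refl
  constant zero    (suc k) ℓ       = trans (cong (ℚ._* e (suc k)) (ℚ.*-zeroˡ (e 0))) (ℚ.*-zeroˡ (e (suc k)))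
  constant (suc n) k       ℓ       = trans (cong (ℚ._* e k) (ℚ.*-zeroˡ (e (suc n)))) (ℚ.*-zeroˡ (e k))

theorem1p1 : F IsQuotient (exp (x + y) - (u - one) ^ 2 * (exp x - one) * (exp y - one)) ÷ (one - u ^ 2 * (exp x - one) * (exp y - one))
theorem1p1 = inverse , denominator-inverse , λ n k ℓ → begin
  F n k ℓ
    ≡⟨ F≈ n k ℓ ⟩
  one n k ℓ ℚ.+ alternatingPowers n k ℓ
    -- The constant 1 is rewritten as the denominator times its inverse, so that both summands share
    -- the factor `inverse`.
    ≡⟨ sym (cong₂ ℚ._+_ (denominator-inverse n k ℓ) (residue-inverse n k ℓ)) ⟩
  (denominator * inverse) n k ℓ ℚ.+ (residue * inverse) n k ℓ
    ≡⟨ sym (*-distribʳ-+ denominator residue inverse n k ℓ) ⟩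
  ((denominator + residue) * inverse) n k ℓ
    ≡⟨ *-cong {B = inverse} (≈-sym numerator≈) (λ _ _ _ → refl) n k ℓ ⟩
  (numerator * inverse) n k ℓ ∎
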